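{- For any $n\ge1$, $$\sum_{\pi\in\mathfrak{S}_n(2413,3142)}(-1)^{\mathsf{des}\,\pi}=\begin{cases}0,&n\text{ even},\\(-1)^{(n-1)/2}\,r_{(n-1)/2},&n\text{ odd},\end{cases}$$ where $r_m:=|\mathfrak{A}_{2m+1}(2413,3142)|$.
   Context: $\mathfrak{S}_n(2413,3142)$ is the set of permutations of $[n]$ avoiding both classical patterns $2413$ and $3142$; $\mathfrak{A}_m(2413,3142)$ is the subset of $\mathfrak{S}_m(2413,3142)$ of alternating (up-down) permutations $\pi(1)<\pi(2)>\pi(3)<\cdots$. $\mathsf{des}\,\pi=\#\{i\in[n-1]:\pi(i)>\pi(i+1)\}$. -}

module Defs where

open import Data.Fin as Fin using (Fin; zero; suc; toℕ; inject₁)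
open import Data.Fin.Properties as Fin using (all?; any?)
open import Data.Integer as ℤ using (ℤ; 0ℤ)
open import Data.List as List using (List; []; _∷_; length; filter; foldr; cartesianProductWith)
open import Data.List.Membership.Propositional using (_∈_; find; lose)
open import Data.List.Membership.Propositional.Properties using (∈-allFin; ∈-cartesianProductWith⁺; ∈-filter⁺; ∈-filter⁻)
import Data.List.Relation.Unary.Any as Any
import Data.List.Relation.Unary.AllPairs as AllPairs
import Data.List.Relation.Unary.All as All
open import Data.List.Relation.Unary.Unique.Propositional using (Unique)
open import Data.List.Relation.Unary.Unique.Propositional.Properties using (cartesianProductWith⁺; allFin⁺; filter⁺)
open import Data.Nat as ℕ using (ℕ; zero; suc; _*_)
open import Data.Nat.Divisibility using (_∣_; _∤_; _∣?_)
open import Data.Product using (∃; _×_; _,_; proj₁; proj₂)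
open import Data.Unit using (⊤; tt)
open import Data.Vec as Vec using (Vec; []; _∷_; lookup)
open import Data.Vec.Properties using (∷-injective)
open import Data.Vec.Relation.Unary.AllPairs using (AllPairs; allPairs?)
open import Function.Bundles using (_⇔_; mk⇔; module Equivalence)
open import Function.Definitions using (Injective; Surjective; Bijective)
open import Relation.Binary.PropositionalEquality using (_≡_; refl)
open import Relation.Nullary using (Dec; yes; ¬_)
open import Relation.Nullary.Decidable using (map′; ¬?; _×-dec_; _→-dec_)

private
  variable
    k m n : ℕ

-- A permutation of [n] is a word π(1) … π(n) in one-line notation whose lookup
-- function is bijective.  Positions and values are shifted down by one, to Fin n.

Word : ℕ → ℕ → Set
Word m k = Vec (Fin m) k

IsPermutation : Word n n → Set
IsPermutation π = Bijective _≡_ _≡_ (lookup π)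

-- A classical pattern is given in one-line notation; only the relative order of
-- its entries matters.

Pattern : ℕ → Set
Pattern k = Vec ℕ k

IsOccurrence : Pattern k → Word m n → Word n k → Set
IsOccurrence σ π p =
  AllPairs Fin._<_ p ×
  (∀ a b → lookup σ a ℕ.< lookup σ b ⇔ lookup π (lookup p a) Fin.< lookup π (lookup p b))

Contains : Pattern k → Word m n → Set
Contains σ π = ∃ (IsOccurrence σ π)

Avoids : Pattern k → Word m n → Set
Avoids σ π = ¬ Contains σ π

p2413 p3142 : Pattern 4
p2413 = 2 ∷ 4 ∷ 1 ∷ 3 ∷ []
p3142 = 3 ∷ 1 ∷ 4 ∷ 2 ∷ []

IsSeparable : Word n n → Set
IsSeparable π = IsPermutation π × Avoids p2413 π × Avoids p3142 π

des : Word m n → ℕ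
des {n = zero}  π = 0
des {n = suc n} π =
  Vec.count (λ i → lookup π (suc i) Fin.<? lookup π (inject₁ i)) (Vec.allFin n)

-- π(1) < π(2) > π(3) < ⋯ ; the 1-based position corresponding to i is suc (toℕ i).

IsAlternating : Word m n → Set
IsAlternating {n = zero}  π = ⊤
IsAlternating {n = suc n} π = ∀ (i : Fin n) →
  (2 ∤ suc (toℕ i) → lookup π (inject₁ i) Fin.< lookup π (suc i)) ×
  (2 ∣ suc (toℕ i) → lookup π (suc i) Fin.< lookup π (inject₁ i))

words : ∀ m k → List (Word m k)
words m zero    = [] ∷ []
words m (suc k) = cartesianProductWith _∷_ (List.allFin m) (words m k)

∈-words : (w : Word m k) → w ∈ words m k
∈-words []      = Any.here refl
∈-words (x ∷ w) = ∈-cartesianProductWith⁺ _∷_ (∈-allFin x) (∈-words w)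

words-unique : ∀ m k → Unique (words m k)
words-unique m zero    = All.[] AllPairs.∷ AllPairs.[]
words-unique m (suc k) =
  cartesianProductWith⁺ _∷_ ∷-injective (allFin⁺ m) (words-unique m k)

_⇔-dec_ : {A B : Set} → Dec A → Dec B → Dec (A ⇔ B)
a? ⇔-dec b? =
  map′ (λ (f , g) → mk⇔ f g) (λ e → Equivalence.to e , Equivalence.from e)
       ((a? →-dec b?) ×-dec (b? →-dec a?))

injective? : (f : Fin m → Fin n) → Dec (Injective _≡_ _≡_ f)
injective? f =
  map′ (λ h {x} {y} → h x y) (λ h x y → h {x} {y})
       (all? λ x → all? λ y → (f x Fin.≟ f y) →-dec (x Fin.≟ y))

surjective? : (f : Fin m → Fin n) → Dec (Surjective _≡_ _≡_ f)
surjective? f =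
  map′ (λ h y → proj₁ (h y) , λ { refl → proj₂ (h y) })
       (λ h y → proj₁ (h y) , proj₂ (h y) refl)
       (all? λ y → any? λ x → f x Fin.≟ y)

isPermutation? : (π : Word n n) → Dec (IsPermutation π)
isPermutation? π = injective? (lookup π) ×-dec surjective? (lookup π)

isOccurrence? : (σ : Pattern k) (π : Word m n) (p : Word n k) → Dec (IsOccurrence σ π p)
isOccurrence? σ π p =
  allPairs? Fin._<?_ p ×-dec
  (all? λ a → all? λ b →
    (lookup σ a ℕ.<? lookup σ b) ⇔-dec (lookup π (lookup p a) Fin.<? lookup π (lookup p b)))

contains? : (σ : Pattern k) (π : Word m n) → Dec (Contains σ π)
contains? {k} {n = n} σ π =
  map′ (λ h → let p , _ , occ = find h in p , occ)
       (λ (p , occ) → lose (∈-words p) occ)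
       (Any.any? (isOccurrence? σ π) (words n k))

isSeparable? : (π : Word n n) → Dec (IsSeparable π)
isSeparable? π =
  isPermutation? π ×-dec ¬? (contains? p2413 π) ×-dec ¬? (contains? p3142 π)

isAlternating? : (π : Word m n) → Dec (IsAlternating π)
isAlternating? {n = zero}  π = yes tt
isAlternating? {n = suc n} π = all? λ i →
  (¬? (2 ∣? suc (toℕ i)) →-dec (lookup π (inject₁ i) Fin.<? lookup π (suc i))) ×-dec
  ((2 ∣? suc (toℕ i)) →-dec (lookup π (suc i) Fin.<? lookup π (inject₁ i)))

-- The finite sets 𝔖ₙ(2413,3142) and 𝔄ₙ(2413,3142), as duplicate-free lists.

𝔖 : ∀ n → List (Word n n)
𝔖 n = filter isSeparable? (words n n)

𝔄 : ∀ n → List (Word n n)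
𝔄 n = filter isAlternating? (𝔖 n)

𝔖-unique : ∀ n → Unique (𝔖 n)
𝔖-unique n = filter⁺ isSeparable? (words-unique n n)

∈-𝔖 : (π : Word n n) → π ∈ 𝔖 n ⇔ IsSeparable π
∈-𝔖 {n} π = mk⇔ (λ h → proj₂ (∈-filter⁻ isSeparable? {xs = words n n} h))
                (∈-filter⁺ isSeparable? (∈-words π))

𝔄-unique : ∀ n → Unique (𝔄 n)
𝔄-unique n = filter⁺ isAlternating? (𝔖-unique n)

∈-𝔄 : (π : Word n n) → π ∈ 𝔄 n ⇔ (IsSeparable π × IsAlternating π)
∈-𝔄 {n} π = mk⇔
  (λ h → let s , a = ∈-filter⁻ isAlternating? {xs = 𝔖 n} h in Equivalence.to (∈-𝔖 π) s , a)
  (λ (s , a) → ∈-filter⁺ isAlternating? (Equivalence.from (∈-𝔖 π) s) a)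

r : ℕ → ℕ
r m = length (𝔄 (suc (2 * m)))

∑ : {A : Set} → List A → (A → ℤ) → ℤ
∑ xs f = foldr (λ x s → f x ℤ.+ s) 0ℤ xs

{-# OPTIONS --safe #-}

-- A separable word of length at least two splits into a lower and an upper block, in one of the two
-- orders.  Always splitting off the shortest possible last block makes this unique, so separable
-- permutations of [n + 1] correspond to binary trees with n inner nodes labelled asc or dsc in which
-- no right child repeats the label of its parent, and the inorder reading of the labels is the
-- descent word.
--
-- Let T be the generating function of these trees by inner nodes, signed by the number of dsc.
-- Its parts P and N with root asc and dsc satisfy P = x T (1 + N), N = - x T (1 + P), T = 1 + P + N,
-- whence T = 1 - x² T² (1 + T).  For trees with alternating inorder word, let A = E + O be the
-- series with its even and odd parts and Q that of the trees whose root, if any, carries the first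
-- letter of the word.  The label of a node is determined by the parity of its position, so
-- Q = 1 + x E Q and A = Q + x O Q; this gives A = 1 + x O + x E A, whose parts are O = x E² and
-- E = 1 + x² E² (1 + E).  Comparing, T(x) arises from E(x) by the substitution x² ↦ - x².
module Submission where

open import Defs
open import Data.Bool using (true; false; if_then_else_)
open import Data.Empty using (⊥; ⊥-elim)
open import Data.Fin as Fin using (Fin; zero; suc; toℕ; inject₁)
open import Data.Fin.Patterns using (0F; 1F; 2F; 3F)
import Data.Fin.Properties as Fin
open import Data.Integer using (ℤ; +_; 0ℤ; 1ℤ; -1ℤ; _+_; _*_; -_; _^_)
import Data.Integer.Properties as ℤ
open import Data.Integer.Solver using (module +-*-Solver)
open import Data.List as List using (List; []; _∷_; [_]; _++_; length; filter; cartesianProductWith)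
import Data.List.Properties as List
open import Data.List.Membership.Propositional using (_∈_; _∉_; find)
open import Data.List.Membership.Propositional.Properties
open import Data.List.Membership.Propositional.Properties.WithK using (unique∧set⇒bag)
open import Data.List.Relation.Binary.BagAndSetEquality using (∼bag⇒↭)
open import Data.List.Relation.Binary.Disjoint.Propositional using (Disjoint)
open import Data.List.Relation.Binary.Permutation.Propositional as Perm using (_↭_)
open import Data.List.Relation.Binary.Sublist.Propositional as Sub using (_⊆_; []; _∷_; _∷ʳ_)
import Data.List.Relation.Binary.Sublist.Propositional.Properties as Sub
import Data.List.Relation.Unary.All as ListAll
import Data.List.Relation.Unary.All.Properties as ListAll
import Data.List.Relation.Unary.AllPairs as ListAllPairs
open import Data.List.Relation.Unary.Any as Any using (here; there)
open import Data.List.Relation.Unary.Unique.Propositional using (Unique)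
import Data.List.Relation.Unary.Unique.Propositional.Properties as Unique
open import Data.Nat as ℕ using (ℕ; zero; suc; z≤n; s≤s; _<_; _≤_; _≥_; _∸_; _/_)
open import Data.Nat.Divisibility using (_∣_; _∤_; _∣?_; ∣m+n∣m⇒∣n; ∣m∣n⇒∣m+n; ∣-refl; divides)
import Data.Nat.DivMod as ℕ
open import Data.Nat.Induction using (<-rec)
import Data.Nat.Properties as ℕ
open import Data.Product using (∃; ∃₂; _×_; _,_; proj₁; proj₂)
open import Data.Sign using (Sign; opposite) renaming (+ to asc; - to dsc)
import Data.Sign.Properties as Sign
open import Data.Sum as Sum using (_⊎_; inj₁; inj₂)
open import Data.Unit using (⊤; tt)
open import Data.Vec as Vec using (Vec; []; _∷_; lookup; count; tabulate)
open import Data.Vec.Relation.Unary.All as All using (All; []; _∷_)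
import Data.Vec.Relation.Unary.All.Properties as All
open import Data.Vec.Relation.Unary.AllPairs as AllPairs using (AllPairs; []; _∷_)
import Data.Vec.Relation.Unary.AllPairs.Properties as AllPairs
open import Function using (_∘_; id; case_of_; _⇔_; mk⇔)
open import Function.Bundles using (module Equivalence)
open import Function.Definitions using (Injective; Surjective)
open import Relation.Binary.Definitions using (tri<; tri≈; tri>)
open import Relation.Binary.PropositionalEquality hiding ([_])
open import Relation.Nullary using (Dec; yes; no; ¬_; does; contradiction)
open import Relation.Nullary.Decidable using (dec-true; dec-false; toWitness; toWitnessFalse; _→-dec_)
open import Relation.Unary using (Decidable)
open +-*-Solver using (solve; _:+_; _:*_; :-_; _:=_; con)
open ≡-Reasoning

private
  variable
    A B C : Set
    k m n : ℕ

-- Formal power series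

Series : Set
Series = ℕ → ℤ

infixl 7 _⊛_
infixl 6 _⊞_

_⊞_ : Series → Series → Series
(f ⊞ g) n = f n + g n

-- The Cauchy product, by recursion along f = `f 0` + x (`f ∘ suc`).
_⊛_ : Series → Series → Series
(f ⊛ g) zero    = f 0 * g 0
(f ⊛ g) (suc n) = f 0 * g (suc n) + ((f ∘ suc) ⊛ g) n

-- Multiplication by x.
shift : Series → Series
shift f zero    = 0ℤ
shift f (suc n) = f n

𝟙 : Series
𝟙 zero    = 1ℤ
𝟙 (suc n) = 0ℤ

-- A coefficient of a product involves no higher coefficients of the factors. This is what lets
-- functional equations be solved by strong induction on the degree.
⊛-cong-≤ : ∀ {f f′ g g′} n → (∀ {i} → i ℕ.≤ n → f i ≡ f′ i) →
           (∀ {i} → i ℕ.≤ n → g i ≡ g′ i) → (f ⊛ g) n ≡ (f′ ⊛ g′) n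
⊛-cong-≤ zero    p q = cong₂ _*_ (p z≤n) (q z≤n)
⊛-cong-≤ (suc n) p q =
  cong₂ _+_ (cong₂ _*_ (p z≤n) (q ℕ.≤-refl))
            (⊛-cong-≤ n (p ∘ s≤s) (q ∘ ℕ.m≤n⇒m≤1+n))

⊛-cong : ∀ {f f′ g g′} → f ≗ f′ → g ≗ g′ → f ⊛ g ≗ f′ ⊛ g′
⊛-cong p q n = ⊛-cong-≤ n (λ _ → p _) (λ _ → q _)

⊛-distribˡ-⊞ : ∀ f g h → f ⊛ (g ⊞ h) ≗ (f ⊛ g) ⊞ (f ⊛ h)
⊛-distribˡ-⊞ f g h zero    = ℤ.*-distribˡ-+ (f 0) (g 0) (h 0)
⊛-distribˡ-⊞ f g h (suc n) rewrite ⊛-distribˡ-⊞ (f ∘ suc) g h n =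
  solve 5 (λ a b c d e → a :* (b :+ c) :+ (d :+ e) := (a :* b :+ d) :+ (a :* c :+ e))
    refl (f 0) (g (suc n)) (h (suc n)) (((f ∘ suc) ⊛ g) n) (((f ∘ suc) ⊛ h) n)

⊛-distribʳ-⊞ : ∀ f g h → (g ⊞ h) ⊛ f ≗ (g ⊛ f) ⊞ (h ⊛ f)
⊛-distribʳ-⊞ f g h zero    = ℤ.*-distribʳ-+ (f 0) (g 0) (h 0)
⊛-distribʳ-⊞ f g h (suc n) rewrite ⊛-distribʳ-⊞ f (g ∘ suc) (h ∘ suc) n =
  solve 5 (λ a b c d e → (b :+ c) :* a :+ (d :+ e) := (b :* a :+ d) :+ (c :* a :+ e))
    refl (f (suc n)) (g 0) (h 0) (((g ∘ suc) ⊛ f) n) (((h ∘ suc) ⊛ f) n)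

⊛-scaleˡ : ∀ c f g n → ((λ i → c * f i) ⊛ g) n ≡ c * (f ⊛ g) n
⊛-scaleˡ c f g zero    = ℤ.*-assoc c (f 0) (g 0)
⊛-scaleˡ c f g (suc n) rewrite ⊛-scaleˡ c (f ∘ suc) g n =
  solve 4 (λ a b d e → a :* b :* d :+ a :* e := a :* (b :* d :+ e))
    refl c (f 0) (g (suc n)) (((f ∘ suc) ⊛ g) n)

⊛-negʳ : ∀ f g n → (f ⊛ (-_ ∘ g)) n ≡ - (f ⊛ g) n
⊛-negʳ f g zero    = sym (ℤ.neg-distribʳ-* (f 0) (g 0))
⊛-negʳ f g (suc n) rewrite ⊛-negʳ (f ∘ suc) g n =
  solve 3 (λ a b c → a :* (:- b) :+ :- c := :- (a :* b :+ c))
    refl (f 0) (g (suc n)) (((f ∘ suc) ⊛ g) n)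

-- The product peeled from its right factor, the mirror image of the defining recursion;
-- commutativity and `⊛-shiftʳ` rest on it.
⊛-sucʳ : ∀ f g n → (f ⊛ g) (suc n) ≡ f (suc n) * g 0 + (f ⊛ (g ∘ suc)) n
⊛-sucʳ f g zero    = ℤ.+-comm (f 0 * g 1) (f 1 * g 0)
⊛-sucʳ f g (suc n) rewrite ⊛-sucʳ (f ∘ suc) g n =
  solve 3 (λ a b c → a :+ (b :+ c) := b :+ (a :+ c))
    refl (f 0 * g (suc (suc n))) (f (suc (suc n)) * g 0) (((f ∘ suc) ⊛ (g ∘ suc)) n)

⊛-comm : ∀ f g → f ⊛ g ≗ g ⊛ f
⊛-comm f g zero    = ℤ.*-comm (f 0) (g 0)
⊛-comm f g (suc n) = begin
  f 0 * g (suc n) + ((f ∘ suc) ⊛ g) n  ≡⟨ cong₂ _+_ (ℤ.*-comm (f 0) (g (suc n))) (⊛-comm (f ∘ suc) g n) ⟩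
  g (suc n) * f 0 + (g ⊛ (f ∘ suc)) n  ≡⟨ ⊛-sucʳ g f n ⟨
  (g ⊛ f) (suc n)                      ∎

⊛-assoc : ∀ f g h → (f ⊛ g) ⊛ h ≗ f ⊛ (g ⊛ h)
⊛-assoc f g h zero    = ℤ.*-assoc (f 0) (g 0) (h 0)
⊛-assoc f g h (suc n) = begin
  f 0 * g 0 * h (suc n) + (((λ i → f 0 * g (suc i)) ⊞ ((f ∘ suc) ⊛ g)) ⊛ h) n
    ≡⟨ cong (λ z → f 0 * g 0 * h (suc n) + z) (⊛-distribʳ-⊞ h (λ i → f 0 * g (suc i)) ((f ∘ suc) ⊛ g) n) ⟩
  f 0 * g 0 * h (suc n) + (((λ i → f 0 * g (suc i)) ⊛ h) n + (((f ∘ suc) ⊛ g) ⊛ h) n)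
    ≡⟨ cong (λ z → f 0 * g 0 * h (suc n) + z)
         (cong₂ _+_ (⊛-scaleˡ (f 0) (g ∘ suc) h n) (⊛-assoc (f ∘ suc) g h n)) ⟩
  f 0 * g 0 * h (suc n) + (f 0 * ((g ∘ suc) ⊛ h) n + ((f ∘ suc) ⊛ (g ⊛ h)) n)
    ≡⟨ solve 5 (λ a b c d e → a :* b :* c :+ (a :* d :+ e) := a :* (b :* c :+ d) :+ e)
         refl (f 0) (g 0) (h (suc n)) (((g ∘ suc) ⊛ h) n) (((f ∘ suc) ⊛ (g ⊛ h)) n) ⟩
  f 0 * (g ⊛ h) (suc n) + ((f ∘ suc) ⊛ (g ⊛ h)) n ∎

⊛-leftComm : ∀ f g h → f ⊛ (g ⊛ h) ≗ g ⊛ (f ⊛ h)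
⊛-leftComm f g h n = begin
  (f ⊛ (g ⊛ h)) n  ≡⟨ ⊛-assoc f g h n ⟨
  (f ⊛ g ⊛ h) n    ≡⟨ ⊛-cong (⊛-comm f g) (λ _ → refl) n ⟩
  (g ⊛ f ⊛ h) n    ≡⟨ ⊛-assoc g f h n ⟩
  (g ⊛ (f ⊛ h)) n  ∎

⊛-zeroʳ : ∀ f g → (∀ n → g n ≡ 0ℤ) → ∀ n → (f ⊛ g) n ≡ 0ℤ
⊛-zeroʳ f g g≡0 zero    rewrite g≡0 0 = ℤ.*-zeroʳ (f 0)
⊛-zeroʳ f g g≡0 (suc n) rewrite g≡0 (suc n) | ⊛-zeroʳ (f ∘ suc) g g≡0 n | ℤ.*-zeroʳ (f 0) = refl

⊛-identityʳ : ∀ f → f ⊛ 𝟙 ≗ f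
⊛-identityʳ f zero    = ℤ.*-identityʳ (f 0)
⊛-identityʳ f (suc n) = begin
  f 0 * 0ℤ + ((f ∘ suc) ⊛ 𝟙) n  ≡⟨ cong₂ _+_ (ℤ.*-zeroʳ (f 0)) (⊛-identityʳ (f ∘ suc) n) ⟩
  0ℤ + f (suc n)                ≡⟨ ℤ.+-identityˡ (f (suc n)) ⟩
  f (suc n)                     ∎

⊛-shiftʳ : ∀ f g → f ⊛ shift g ≗ shift (f ⊛ g)
⊛-shiftʳ f g zero    = ℤ.*-zeroʳ (f 0)
⊛-shiftʳ f g (suc n) = begin
  (f ⊛ shift g) (suc n)          ≡⟨ ⊛-sucʳ f (shift g) n ⟩
  f (suc n) * 0ℤ + (f ⊛ g) n     ≡⟨ cong (_+ (f ⊛ g) n) (ℤ.*-zeroʳ (f (suc n))) ⟩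
  0ℤ + (f ⊛ g) n                 ≡⟨ ℤ.+-identityˡ _ ⟩
  (f ⊛ g) n                      ∎

-- The substitution x ↦ - x, and even and odd parts

twist : Series → Series
twist f n = -1ℤ ^ n * f n

twist-⊛ : ∀ f g → twist f ⊛ twist g ≗ twist (f ⊛ g)
twist-⊛ f g zero    = solve 2 (λ a b → con 1ℤ :* a :* (con 1ℤ :* b) := con 1ℤ :* (a :* b)) refl (f 0) (g 0)
twist-⊛ f g (suc n) = begin
  1ℤ * f 0 * (-1ℤ ^ suc n * g (suc n)) + ((twist f ∘ suc) ⊛ twist g) n
    ≡⟨ cong (λ z → 1ℤ * f 0 * (-1ℤ ^ suc n * g (suc n)) + z) (begin
         ((twist f ∘ suc) ⊛ twist g) n
           ≡⟨ ⊛-cong (λ i → ℤ.*-assoc -1ℤ (-1ℤ ^ i) (f (suc i))) (λ _ → refl) n ⟩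
         ((λ i → -1ℤ * twist (f ∘ suc) i) ⊛ twist g) n
           ≡⟨ ⊛-scaleˡ -1ℤ (twist (f ∘ suc)) (twist g) n ⟩
         -1ℤ * (twist (f ∘ suc) ⊛ twist g) n
           ≡⟨ cong (-1ℤ *_) (twist-⊛ (f ∘ suc) g n) ⟩
         -1ℤ * twist ((f ∘ suc) ⊛ g) n ∎) ⟩
  1ℤ * f 0 * (-1ℤ ^ suc n * g (suc n)) + -1ℤ * (-1ℤ ^ n * ((f ∘ suc) ⊛ g) n)
    ≡⟨ solve 4 (λ a b c d → con 1ℤ :* a :* (con -1ℤ :* b :* c) :+ con -1ℤ :* (b :* d)
                 := con -1ℤ :* b :* (a :* c :+ d))
         refl (f 0) (-1ℤ ^ n) (g (suc n)) (((f ∘ suc) ⊛ g) n) ⟩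
  twist (f ⊛ g) (suc n) ∎

-- Unlike `2 * n`, this reduces to two successors at each step, in line with the recursion of series
-- by dropping two coefficients.
double : ℕ → ℕ
double zero    = zero
double (suc n) = suc (suc (double n))

-- These are compressed: f(x) = `evens f` (x²) + x `odds f` (x²). In contrast, `evenPart` and
-- `oddPart` keep the exponents.
evens odds : Series → Series
evens f n = f (double n)
odds  f n = f (suc (double n))

IsEven : Series → Set
IsEven f = ∀ n → odds f n ≡ 0ℤ

-- An even factor f does not mix degrees of different parity, so it acts on the even and on the odd
-- coefficients of g separately.
evens-⊛ : ∀ f g → IsEven f → evens (f ⊛ g) ≗ evens f ⊛ evens g
evens-⊛ f g ev zero    = refl
evens-⊛ f g ev (suc n) = begin
  f 0 * g (double (suc n)) + (f 1 * g (suc (double n)) + evens ((f ∘ ℕ.suc ∘ ℕ.suc) ⊛ g) n)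
    ≡⟨ cong (λ z → f 0 * g (double (suc n)) + (z * g (suc (double n)) + evens ((f ∘ ℕ.suc ∘ ℕ.suc) ⊛ g) n)) (ev 0) ⟩
  f 0 * g (double (suc n)) + (0ℤ + evens ((f ∘ ℕ.suc ∘ ℕ.suc) ⊛ g) n)
    ≡⟨ cong (λ z → f 0 * g (double (suc n)) + z)
         (trans (ℤ.+-identityˡ _) (evens-⊛ (f ∘ ℕ.suc ∘ ℕ.suc) g (ev ∘ suc) n)) ⟩
  f 0 * g (double (suc n)) + ((evens f ∘ suc) ⊛ evens g) n ∎

odds-⊛ : ∀ f g → IsEven f → odds (f ⊛ g) ≗ evens f ⊛ odds g
odds-⊛ f g ev zero    = begin
  f 0 * g 1 + f 1 * g 0  ≡⟨ cong (λ z → f 0 * g 1 + z * g 0) (ev 0) ⟩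
  f 0 * g 1 + 0ℤ         ≡⟨ ℤ.+-identityʳ _ ⟩
  f 0 * g 1              ∎
odds-⊛ f g ev (suc n) = begin
  f 0 * g (suc (double (suc n))) + (f 1 * g (double (suc n)) + odds ((f ∘ ℕ.suc ∘ ℕ.suc) ⊛ g) n)
    ≡⟨ cong (λ z → f 0 * g (suc (double (suc n))) + (z * g (double (suc n)) + odds ((f ∘ ℕ.suc ∘ ℕ.suc) ⊛ g) n)) (ev 0) ⟩
  f 0 * g (suc (double (suc n))) + (0ℤ + odds ((f ∘ ℕ.suc ∘ ℕ.suc) ⊛ g) n)
    ≡⟨ cong (λ z → f 0 * g (suc (double (suc n))) + z)
         (trans (ℤ.+-identityˡ _) (odds-⊛ (f ∘ ℕ.suc ∘ ℕ.suc) g (ev ∘ suc) n)) ⟩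
  f 0 * g (suc (double (suc n))) + ((evens f ∘ suc) ⊛ odds g) n ∎

⊛-isEven : ∀ f g → IsEven f → IsEven g → IsEven (f ⊛ g)
⊛-isEven f g evf evg n = trans (odds-⊛ f g evf n) (⊛-zeroʳ (evens f) (odds g) evg n)

evenPart oddPart : Series → Series
evenPart f zero          = f 0
evenPart f (suc zero)    = 0ℤ
evenPart f (suc (suc n)) = evenPart (f ∘ ℕ.suc ∘ ℕ.suc) n
oddPart f zero    = 0ℤ
oddPart f (suc n) = evenPart (f ∘ suc) n

evenPart-isEven : ∀ f → IsEven (evenPart f)
evenPart-isEven f zero    = refl
evenPart-isEven f (suc n) = evenPart-isEven (f ∘ ℕ.suc ∘ ℕ.suc) n

evens-evenPart : ∀ f → evens (evenPart f) ≗ evens f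
evens-evenPart f zero    = refl
evens-evenPart f (suc n) = evens-evenPart (f ∘ ℕ.suc ∘ ℕ.suc) n

odds-oddPart : ∀ f → odds (oddPart f) ≗ odds f
odds-oddPart f = evens-evenPart (f ∘ suc)

evens-oddPart : ∀ f n → evens (oddPart f) n ≡ 0ℤ
evens-oddPart f zero    = refl
evens-oddPart f (suc n) = evenPart-isEven (f ∘ suc) n

evenPart-cong-≤ : ∀ {f g} n → (∀ {i} → i ℕ.≤ n → f i ≡ g i) → evenPart f n ≡ evenPart g n
evenPart-cong-≤ zero          p = p z≤n
evenPart-cong-≤ (suc zero)    p = refl
evenPart-cong-≤ (suc (suc n)) p = evenPart-cong-≤ n (p ∘ s≤s ∘ s≤s)

oddPart-cong-≤ : ∀ {f g} n → (∀ {i} → i ℕ.≤ n → f i ≡ g i) → oddPart f n ≡ oddPart g n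
oddPart-cong-≤ zero    p = refl
oddPart-cong-≤ (suc n) p = evenPart-cong-≤ n (p ∘ s≤s)

-- The two functional equations

-- f² (1 + f), the nonlinear term common to both equations.
cubic : Series → Series
cubic f = f ⊛ (f ⊞ f ⊛ f)

-- The equation f = 1 - x² f² (1 + f), coefficient by coefficient.
record Signed (f : Series) : Set where
  field
    at0 : f 0 ≡ 1ℤ
    at1 : f 1 ≡ 0ℤ
    at2+ : ∀ n → f (suc (suc n)) ≡ - cubic f n

cubic-cong-≤ : ∀ {f g} n → (∀ {i} → i ℕ.≤ n → f i ≡ g i) → cubic f n ≡ cubic g n
cubic-cong-≤ n p = ⊛-cong-≤ n p λ i≤n → cong₂ _+_ (p i≤n)
  (⊛-cong-≤ _ (λ j≤i → p (ℕ.≤-trans j≤i i≤n)) (λ j≤i → p (ℕ.≤-trans j≤i i≤n)))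

-- The factor x² makes coefficient n + 2 a function of the coefficients up to n, so strong induction
-- applies.
signed-unique : ∀ {f g} → Signed f → Signed g → f ≗ g
signed-unique {f} {g} F G = <-rec (λ n → f n ≡ g n) step
  where
  module F = Signed F
  module G = Signed G

  step : ∀ n → (∀ {i} → i ℕ.< n → f i ≡ g i) → f n ≡ g n
  step zero          ih = trans F.at0 (sym G.at0)
  step (suc zero)    ih = trans F.at1 (sym G.at1)
  step (suc (suc n)) ih = begin
    f (suc (suc n))  ≡⟨ F.at2+ n ⟩
    - cubic f n      ≡⟨ cong -_ (cubic-cong-≤ n (λ i≤n → ih (s≤s (ℕ.m≤n⇒m≤1+n i≤n)))) ⟩
    - cubic g n      ≡⟨ G.at2+ n ⟨
    g (suc (suc n))  ∎

-- f(x) ↦ f(- x²)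

dilate : Series → Series
dilate f zero          = f 0
dilate f (suc zero)    = 0ℤ
dilate f (suc (suc n)) = - dilate (f ∘ suc) n

dilate-isEven : ∀ f → IsEven (dilate f)
dilate-isEven f zero    = refl
dilate-isEven f (suc n) rewrite dilate-isEven (f ∘ suc) n = refl

evens-dilate : ∀ f → evens (dilate f) ≗ twist f
evens-dilate f zero    = sym (ℤ.*-identityˡ (f 0))
evens-dilate f (suc n) rewrite evens-dilate (f ∘ suc) n =
  solve 2 (λ a b → :- (a :* b) := con -1ℤ :* a :* b) refl (-1ℤ ^ n) (f (suc n))

isEven-ext : ∀ {f g} → IsEven f → IsEven g → evens f ≗ evens g → f ≗ g
isEven-ext evf evg p zero          = p 0
isEven-ext evf evg p (suc zero)    = trans (evf 0) (sym (evg 0))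
isEven-ext evf evg p (suc (suc n)) = isEven-ext (evf ∘ suc) (evg ∘ suc) (p ∘ suc) n

-- Both sides are even series, and on even coefficients `dilate` is `twist`, which is
-- multiplicative.
dilate-⊛ : ∀ f g → dilate f ⊛ dilate g ≗ dilate (f ⊛ g)
dilate-⊛ f g = isEven-ext (⊛-isEven (dilate f) (dilate g) (dilate-isEven f) (dilate-isEven g))
                        (dilate-isEven (f ⊛ g)) λ n → begin
  evens (dilate f ⊛ dilate g) n          ≡⟨ evens-⊛ (dilate f) (dilate g) (dilate-isEven f) n ⟩
  (evens (dilate f) ⊛ evens (dilate g)) n ≡⟨ ⊛-cong (evens-dilate f) (evens-dilate g) n ⟩
  (twist f ⊛ twist g) n                  ≡⟨ twist-⊛ f g n ⟩
  twist (f ⊛ g) n                        ≡⟨ evens-dilate (f ⊛ g) n ⟨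
  evens (dilate (f ⊛ g)) n               ∎

dilate-⊞ : ∀ f g → dilate f ⊞ dilate g ≗ dilate (f ⊞ g)
dilate-⊞ f g zero          = refl
dilate-⊞ f g (suc zero)    = refl
dilate-⊞ f g (suc (suc n)) = trans (sym (ℤ.neg-distrib-+ (dilate (f ∘ suc) n) (dilate (g ∘ suc) n)))
                                   (cong -_ (dilate-⊞ (f ∘ suc) (g ∘ suc) n))

dilate-cong : ∀ {f g} → f ≗ g → dilate f ≗ dilate g
dilate-cong p zero          = p 0
dilate-cong p (suc zero)    = refl
dilate-cong p (suc (suc n)) = cong -_ (dilate-cong (p ∘ suc) n)

-- Substituting - x² for x turns f = 1 + x f² (1 + f) into the equation of `Signed`, since `dilate`
-- respects sums and products.
dilate-signed : ∀ {f} → f 0 ≡ 1ℤ → (∀ n → f (suc n) ≡ cubic f n) → Signed (dilate f)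
dilate-signed {f} f0 fs = record
  { at0  = f0
  ; at1  = refl
  ; at2+ = λ n → cong -_ (begin
      dilate (f ∘ suc) n                           ≡⟨ dilate-cong fs n ⟩
      dilate (cubic f) n                           ≡⟨ dilate-⊛ f (f ⊞ f ⊛ f) n ⟨
      (dilate f ⊛ dilate (f ⊞ f ⊛ f)) n            ≡⟨ ⊛-cong (λ _ → refl) (λ i →
          trans (sym (dilate-⊞ f (f ⊛ f) i)) (cong (λ z → dilate f i + z) (sym (dilate-⊛ f f i)))) n ⟩
      cubic (dilate f) n                           ∎)
  }

-- Adding the last two equations gives t = 1 + x t (q - p); subtracting them gives q - p = - x t (2
-- + p + q) = - x t (1 + t), which is `difference`.
signed-system : ∀ (t p q : Series) → t ≗ 𝟙 ⊞ p ⊞ q → p ≗ shift (t ⊛ (𝟙 ⊞ q)) →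
                q ≗ -_ ∘ shift (t ⊛ (𝟙 ⊞ p)) → Signed t
signed-system t p q t≗ p≗ q≗ = record
  { at0  = t0
  ; at1  = begin
      t 1                                       ≡⟨ t≗ 1 ⟩
      0ℤ + p 1 + q 1                            ≡⟨ cong₂ (λ a b → 0ℤ + a + b) (p≗ 1) (q≗ 1) ⟩
      0ℤ + t 0 * (1ℤ + q 0) + - (t 0 * (1ℤ + p 0))
        ≡⟨ cong₂ (λ a b → 0ℤ + t 0 * (1ℤ + a) + - (t 0 * (1ℤ + b))) (q≗ 0) (p≗ 0) ⟩
      0ℤ + t 0 * 1ℤ + - (t 0 * 1ℤ)
        ≡⟨ solve 1 (λ a → con 0ℤ :+ a :* con 1ℤ :+ :- (a :* con 1ℤ) := con 0ℤ) refl (t 0) ⟩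
      0ℤ                                        ∎
  ; at2+ = λ n → begin
      t (suc (suc n))                           ≡⟨ t≗ (suc (suc n)) ⟩
      0ℤ + p (suc (suc n)) + q (suc (suc n))    ≡⟨ cong₂ (λ a b → 0ℤ + a + b) (p≗ _) (q≗ _) ⟩
      0ℤ + (t ⊛ (𝟙 ⊞ q)) (suc n) + - (t ⊛ (𝟙 ⊞ p)) (suc n)
        ≡⟨ cong (λ z → 0ℤ + (t ⊛ (𝟙 ⊞ q)) (suc n) + z) (sym (⊛-negʳ t (𝟙 ⊞ p) (suc n))) ⟩
      0ℤ + (t ⊛ (𝟙 ⊞ q)) (suc n) + (t ⊛ (-_ ∘ (𝟙 ⊞ p))) (suc n)
        ≡⟨ cong (_+ (t ⊛ (-_ ∘ (𝟙 ⊞ p))) (suc n)) (ℤ.+-identityˡ ((t ⊛ (𝟙 ⊞ q)) (suc n))) ⟩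
      (t ⊛ (𝟙 ⊞ q)) (suc n) + (t ⊛ (-_ ∘ (𝟙 ⊞ p))) (suc n)
        ≡⟨ ⊛-distribˡ-⊞ t (𝟙 ⊞ q) (-_ ∘ (𝟙 ⊞ p)) (suc n) ⟨
      (t ⊛ ((𝟙 ⊞ q) ⊞ (-_ ∘ (𝟙 ⊞ p)))) (suc n)  ≡⟨ ⊛-cong {f = t} (λ _ → refl) difference (suc n) ⟩
      (t ⊛ shift (-_ ∘ (t ⊞ t ⊛ t))) (suc n)    ≡⟨ ⊛-shiftʳ t (-_ ∘ (t ⊞ t ⊛ t)) (suc n) ⟩
      (t ⊛ (-_ ∘ (t ⊞ t ⊛ t))) n                ≡⟨ ⊛-negʳ t (t ⊞ t ⊛ t) n ⟩
      - cubic t n                               ∎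
  }
  where
  t0 : t 0 ≡ 1ℤ
  t0 = trans (t≗ 0) (cong₂ (λ a b → 1ℤ + a + b) (p≗ 0) (q≗ 0))

  difference : (𝟙 ⊞ q) ⊞ (-_ ∘ (𝟙 ⊞ p)) ≗ shift (-_ ∘ (t ⊞ t ⊛ t))
  difference zero = cong₂ (λ a b → 1ℤ + a + - (1ℤ + b)) (q≗ 0) (p≗ 0)
  difference (suc n) = begin
    0ℤ + q (suc n) + - (0ℤ + p (suc n))
      ≡⟨ cong₂ (λ a b → 0ℤ + a + - (0ℤ + b)) (q≗ _) (p≗ _) ⟩
    0ℤ + - (t ⊛ (𝟙 ⊞ p)) n + - (0ℤ + (t ⊛ (𝟙 ⊞ q)) n)
      ≡⟨ solve 2 (λ a b → con 0ℤ :+ :- a :+ :- (con 0ℤ :+ b) := :- (a :+ b))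
           refl ((t ⊛ (𝟙 ⊞ p)) n) ((t ⊛ (𝟙 ⊞ q)) n) ⟩
    - ((t ⊛ (𝟙 ⊞ p)) n + (t ⊛ (𝟙 ⊞ q)) n)
      ≡⟨ cong -_ (⊛-distribˡ-⊞ t (𝟙 ⊞ p) (𝟙 ⊞ q) n) ⟨
    - (t ⊛ ((𝟙 ⊞ p) ⊞ (𝟙 ⊞ q))) n
      ≡⟨ cong -_ (⊛-cong (λ _ → refl) total n) ⟩
    - (t ⊛ (𝟙 ⊞ t)) n
      ≡⟨ cong -_ (⊛-distribˡ-⊞ t 𝟙 t n) ⟩
    - ((t ⊛ 𝟙) n + (t ⊛ t) n)
      ≡⟨ cong (λ z → - (z + (t ⊛ t) n)) (⊛-identityʳ t n) ⟩
    - (t n + (t ⊛ t) n) ∎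
    where
    total : (𝟙 ⊞ p) ⊞ (𝟙 ⊞ q) ≗ 𝟙 ⊞ t
    total i rewrite t≗ i =
      solve 3 (λ a b c → (a :+ b) :+ (a :+ c) := a :+ (a :+ b :+ c)) refl (𝟙 i) (p i) (q i)

-- After q is eliminated, a = 1 + x O + x E a. In odd degrees the term x O contributes nothing, so
-- the odd coefficients form the square of the even ones; in positive even degrees the equation then
-- gives the cubic term.
alternating-system : ∀ (a q : Series) → q ≗ 𝟙 ⊞ shift (evenPart a ⊛ q) →
                     a ≗ q ⊞ shift (oddPart a ⊛ q) →
                     (evens a 0 ≡ 1ℤ) × (∀ n → evens a (suc n) ≡ cubic (evens a) n)
alternating-system a q q≗ a≗ = trans (a≗ 0) (cong (_+ 0ℤ) (q≗ 0)) , λ n → begin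
    a (suc (suc (double n)))
      ≡⟨ recurrence (suc (double n)) ⟩
    O (suc (double n)) + (E ⊛ a) (suc (double n))
      ≡⟨ cong₂ _+_ (odds-oddPart a n)
           (trans (odds-⊛ E a (evenPart-isEven a) n) (⊛-cong (evens-evenPart a) (λ _ → refl) n)) ⟩
    odds a n + (evens a ⊛ odds a) n
      ≡⟨ cong₂ _+_ (odds≗ n) (⊛-cong (λ _ → refl) odds≗ n) ⟩
    (evens a ⊛ evens a) n + (evens a ⊛ (evens a ⊛ evens a)) n
      ≡⟨ ⊛-distribˡ-⊞ (evens a) (evens a) (evens a ⊛ evens a) n ⟨
    cubic (evens a) n ∎
  where
  E O : Series
  E = evenPart a
  O = oddPart a

  -- Expanding q = 1 + x E q inside O q leaves O plus E times x O q. As x O q is the difference a -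
  -- q, adding E q completes E a in `recurrence`.
  O⊛q : O ⊛ q ≗ O ⊞ (E ⊛ shift (O ⊛ q))
  O⊛q n = begin
    (O ⊛ q) n                            ≡⟨ ⊛-cong (λ _ → refl) q≗ n ⟩
    (O ⊛ (𝟙 ⊞ shift (E ⊛ q))) n          ≡⟨ ⊛-distribˡ-⊞ O 𝟙 (shift (E ⊛ q)) n ⟩
    (O ⊛ 𝟙) n + (O ⊛ shift (E ⊛ q)) n    ≡⟨ cong₂ _+_ (⊛-identityʳ O n) (⊛-shiftʳ O (E ⊛ q) n) ⟩
    O n + shift (O ⊛ (E ⊛ q)) n          ≡⟨ cong (λ z → O n + z) (shift-leftComm n) ⟩
    O n + shift (E ⊛ (O ⊛ q)) n          ≡⟨ cong (λ z → O n + z) (⊛-shiftʳ E (O ⊛ q) n) ⟨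
    O n + (E ⊛ shift (O ⊛ q)) n          ∎
    where
    shift-leftComm : shift (O ⊛ (E ⊛ q)) ≗ shift (E ⊛ (O ⊛ q))
    shift-leftComm zero    = refl
    shift-leftComm (suc i) = ⊛-leftComm O E q i

  recurrence : ∀ n → a (suc n) ≡ O n + (E ⊛ a) n
  recurrence n = begin
    a (suc n)                                      ≡⟨ a≗ (suc n) ⟩
    q (suc n) + (O ⊛ q) n                          ≡⟨ cong₂ _+_ (q≗ (suc n)) (O⊛q n) ⟩
    0ℤ + (E ⊛ q) n + (O n + (E ⊛ shift (O ⊛ q)) n)
      ≡⟨ solve 3 (λ x y z → con 0ℤ :+ x :+ (y :+ z) := y :+ (x :+ z)) refl ((E ⊛ q) n) (O n) ((E ⊛ shift (O ⊛ q)) n) ⟩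
    O n + ((E ⊛ q) n + (E ⊛ shift (O ⊛ q)) n)      ≡⟨ cong (λ z → O n + z) (⊛-distribˡ-⊞ E q (shift (O ⊛ q)) n) ⟨
    O n + (E ⊛ (q ⊞ shift (O ⊛ q))) n              ≡⟨ cong (λ z → O n + z) (⊛-cong (λ _ → refl) a≗ n) ⟨
    O n + (E ⊛ a) n                                ∎

  odds≗ : odds a ≗ evens a ⊛ evens a
  odds≗ n = begin
    a (suc (double n))                 ≡⟨ recurrence (double n) ⟩
    O (double n) + (E ⊛ a) (double n)  ≡⟨ cong₂ _+_ (evens-oddPart a n) (evens-⊛ E a (evenPart-isEven a) n) ⟩
    0ℤ + (evens E ⊛ evens a) n         ≡⟨ ℤ.+-identityˡ _ ⟩
    (evens E ⊛ evens a) n              ≡⟨ ⊛-cong (evens-evenPart a) (λ _ → refl) n ⟩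
    (evens a ⊛ evens a) n              ∎

-- Finite sums

∑-++ : ∀ (xs ys : List A) f → ∑ (xs ++ ys) f ≡ ∑ xs f + ∑ ys f
∑-++ []       ys f = sym (ℤ.+-identityˡ _)
∑-++ (x ∷ xs) ys f = trans (cong (λ z → f x + z) (∑-++ xs ys f)) (sym (ℤ.+-assoc (f x) _ _))

∑-cong : ∀ (xs : List A) f g → (∀ {x} → x ∈ xs → f x ≡ g x) → ∑ xs f ≡ ∑ xs g
∑-cong []       f g p = refl
∑-cong (x ∷ xs) f g p = cong₂ _+_ (p (here refl)) (∑-cong xs f g (p ∘ there))

∑-map : ∀ (h : A → B) xs f → ∑ (List.map h xs) f ≡ ∑ xs (f ∘ h)
∑-map h []       f = refl
∑-map h (x ∷ xs) f = cong (λ z → f (h x) + z) (∑-map h xs f)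

∑-*ˡ : ∀ c (xs : List A) f → ∑ xs (λ x → c * f x) ≡ c * ∑ xs f
∑-*ˡ c []       f = sym (ℤ.*-zeroʳ c)
∑-*ˡ c (x ∷ xs) f = trans (cong (λ z → c * f x + z) (∑-*ˡ c xs f)) (sym (ℤ.*-distribˡ-+ c (f x) _))

∑-↭ : ∀ {xs ys : List A} f → xs ↭ ys → ∑ xs f ≡ ∑ ys f
∑-↭ f Perm.refl          = refl
∑-↭ f (Perm.prep x p)    = cong (λ z → f x + z) (∑-↭ f p)
∑-↭ f (Perm.swap {xs} {ys} x y p) = begin
  f x + (f y + ∑ xs f)  ≡⟨ cong (λ z → f x + (f y + z)) (∑-↭ f p) ⟩
  f x + (f y + ∑ ys f)  ≡⟨ solve 3 (λ a b c → a :+ (b :+ c) := b :+ (a :+ c)) refl (f x) (f y) (∑ ys f) ⟩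
  f y + (f x + ∑ ys f)  ∎
∑-↭ f (Perm.trans p q)   = trans (∑-↭ f p) (∑-↭ f q)

-- Duplicate-free lists with the same members are permutations of each other. Bijections can thus be
-- used without matching the orders of enumeration.
∑-set : ∀ {xs ys : List A} f → Unique xs → Unique ys → (∀ {x} → x ∈ xs ⇔ x ∈ ys) → ∑ xs f ≡ ∑ ys f
∑-set f xs! ys! eq = ∑-↭ f (∼bag⇒↭ (unique∧set⇒bag xs! ys! eq))

∑-cartesianProductWith : ∀ (h : A → B → C) xs ys (f : C → ℤ) (g : A → ℤ) (k : B → ℤ) →
  (∀ x y → f (h x y) ≡ g x * k y) → ∑ (cartesianProductWith h xs ys) f ≡ ∑ xs g * ∑ ys k
∑-cartesianProductWith h []       ys f g k p = refl
∑-cartesianProductWith h (x ∷ xs) ys f g k p = begin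
  ∑ (List.map (h x) ys ++ cartesianProductWith h xs ys) f
    ≡⟨ ∑-++ (List.map (h x) ys) _ f ⟩
  ∑ (List.map (h x) ys) f + ∑ (cartesianProductWith h xs ys) f
    ≡⟨ cong₂ _+_ (∑-map (h x) ys f) (∑-cartesianProductWith h xs ys f g k p) ⟩
  ∑ ys (f ∘ h x) + ∑ xs g * ∑ ys k
    ≡⟨ cong (_+ ∑ xs g * ∑ ys k) (trans (∑-cong ys _ _ (λ _ → p x _)) (∑-*ˡ (g x) ys k)) ⟩
  g x * ∑ ys k + ∑ xs g * ∑ ys k
    ≡⟨ ℤ.*-distribʳ-+ (∑ ys k) (g x) (∑ xs g) ⟨
  (g x + ∑ xs g) * ∑ ys k ∎

-- The combinatorial counterpart of `_⊛_`, with the same recursion: all `h x y` whose degrees add up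
-- to n.
convolve : (A → B → C) → (ℕ → List A) → (ℕ → List B) → ℕ → List C
convolve h f g zero    = cartesianProductWith h (f 0) (g 0)
convolve h f g (suc n) = cartesianProductWith h (f 0) (g (suc n)) ++ convolve h (f ∘ suc) g n

∑-convolve : ∀ (h : A → B → C) f g n (w : C → ℤ) (u : A → ℤ) (v : B → ℤ) →
  (∀ x y → w (h x y) ≡ u x * v y) →
  ∑ (convolve h f g n) w ≡ ((λ i → ∑ (f i) u) ⊛ (λ j → ∑ (g j) v)) n
∑-convolve h f g zero    w u v p = ∑-cartesianProductWith h (f 0) (g 0) w u v p
∑-convolve h f g (suc n) w u v p =
  trans (∑-++ (cartesianProductWith h (f 0) (g (suc n))) _ w)
        (cong₂ _+_ (∑-cartesianProductWith h (f 0) (g (suc n)) w u v p) (∑-convolve h (f ∘ suc) g n w u v p))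

∈-convolve⁺ : ∀ (h : A → B → C) f g i j {x y} → x ∈ f i → y ∈ g j → h x y ∈ convolve h f g (i ℕ.+ j)
∈-convolve⁺ h f g zero    zero    x∈ y∈ = ∈-cartesianProductWith⁺ h x∈ y∈
∈-convolve⁺ h f g zero    (suc j) x∈ y∈ = ∈-++⁺ˡ (∈-cartesianProductWith⁺ h x∈ y∈)
∈-convolve⁺ h f g (suc i) j       x∈ y∈ = ∈-++⁺ʳ _ (∈-convolve⁺ h (f ∘ suc) g i j x∈ y∈)

∈-convolve⁻ : ∀ (h : A → B → C) f g n {z} → z ∈ convolve h f g n →
  ∃₂ λ i j → ∃₂ λ x y → i ℕ.+ j ≡ n × x ∈ f i × y ∈ g j × z ≡ h x y
∈-convolve⁻ h f g zero z∈ =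
  let x , y , x∈ , y∈ , eq = ∈-cartesianProductWith⁻ h (f 0) (g 0) z∈
  in 0 , 0 , x , y , refl , x∈ , y∈ , eq
∈-convolve⁻ h f g (suc n) z∈ with ∈-++⁻ (cartesianProductWith h (f 0) (g (suc n))) z∈
... | inj₁ z∈ˡ =
  let x , y , x∈ , y∈ , eq = ∈-cartesianProductWith⁻ h (f 0) (g (suc n)) z∈ˡ
  in 0 , suc n , x , y , refl , x∈ , y∈ , eq
... | inj₂ z∈ʳ =
  let i , j , x , y , i+j≡n , x∈ , y∈ , eq = ∈-convolve⁻ h (f ∘ suc) g n z∈ʳ
  in suc i , j , x , y , cong suc i+j≡n , x∈ , y∈ , eq

-- The hypothesis on f says that an object determines its degree; together with injectivity of h it
-- keeps the products for different degrees disjoint.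
convolve-unique : ∀ (h : A → B → C) f g n → (∀ {w x y z} → h w y ≡ h x z → w ≡ x × y ≡ z) →
  (∀ {x i j} → x ∈ f i → x ∈ f j → i ≡ j) → (∀ i → Unique (f i)) → (∀ j → Unique (g j)) →
  Unique (convolve h f g n)
convolve-unique h f g zero    inj graded f! g! = Unique.cartesianProductWith⁺ h inj (f! 0) (g! 0)
convolve-unique h f g (suc n) inj graded f! g! =
  Unique.++⁺ (Unique.cartesianProductWith⁺ h inj (f! 0) (g! (suc n)))
             (convolve-unique h (f ∘ suc) g n inj (λ p q → ℕ.suc-injective (graded p q)) (f! ∘ suc) g!)
             disjoint
  where
  disjoint : Disjoint (cartesianProductWith h (f 0) (g (suc n))) (convolve h (f ∘ suc) g n)
  disjoint (z∈ˡ , z∈ʳ)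
    with x , _ , x∈ , _ , refl ← ∈-cartesianProductWith⁻ h (f 0) (g (suc n)) z∈ˡ
       | i , j , x′ , _ , _ , x′∈ , _ , eq ← ∈-convolve⁻ h (f ∘ suc) g n z∈ʳ
    with refl ← proj₁ (inj eq)
    with () ← graded x∈ x′∈

-- Separating trees

data Tree : Set where
  leaf : Tree
  node : Sign → Tree → Tree → Tree

nodes leaves : Tree → ℕ
nodes leaf         = 0
nodes (node s l r) = suc (nodes l ℕ.+ nodes r)
leaves t = suc (nodes t)

inorder : Tree → List Sign
inorder leaf         = []
inorder (node s l r) = inorder l ++ s ∷ inorder r

length-inorder : ∀ t → length (inorder t) ≡ nodes t
length-inorder leaf         = refl
length-inorder (node s l r) = begin
  length (inorder l ++ s ∷ inorder r)               ≡⟨ List.length-++ (inorder l) ⟩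
  length (inorder l) ℕ.+ suc (length (inorder r))   ≡⟨ cong₂ (λ a b → a ℕ.+ suc b) (length-inorder l) (length-inorder r) ⟩
  nodes l ℕ.+ suc (nodes r)                         ≡⟨ ℕ.+-suc (nodes l) (nodes r) ⟩
  suc (nodes l ℕ.+ nodes r)                         ∎

-- With only two signs, a label other than s is `opposite s`; stated as an equation, this can be
-- matched with `refl`.
NotRooted : Sign → Tree → Set
NotRooted s leaf          = ⊤
NotRooted s (node s′ _ _) = s′ ≡ opposite s

-- A right child repeating the label of its parent would allow a shorter last block to be split off;
-- left children are unrestricted.
data Canonical : Tree → Set where
  leaf : Canonical leaf
  node : ∀ {s l r} → Canonical l → Canonical r → NotRooted s r → Canonical (node s l r)

leafs : ℕ → List Tree
leafs zero    = leaf ∷ []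
leafs (suc n) = []

-- The height bound k makes the recursion structural; the list is complete as soon as n ≤ k.

rooted : ℕ → Sign → ℕ → List Tree
rooted zero    s n       = []
rooted (suc k) s zero    = []
rooted (suc k) s (suc n) = convolve (node s)
  (λ i → leafs i ++ (rooted k asc i ++ rooted k dsc i))
  (λ j → leafs j ++ rooted k (opposite s) j) n

-- The recursive clause of `rooted` spells out `trees k` and `notRooted k s`, so the named lists
-- agree with it definitionally.
trees : ℕ → ℕ → List Tree
trees k n = leafs n ++ (rooted k asc n ++ rooted k dsc n)

notRooted : ℕ → Sign → ℕ → List Tree
notRooted k s n = leafs n ++ rooted k (opposite s) n

∈-leafs⁻ : ∀ n {t} → t ∈ leafs n → t ≡ leaf × nodes t ≡ n
∈-leafs⁻ zero (here refl) = refl , refl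

∈-trees⁻′ : ∀ k n {t} → t ∈ trees k n → t ∈ leafs n ⊎ t ∈ rooted k asc n ⊎ t ∈ rooted k dsc n
∈-trees⁻′ k n t∈ with ∈-++⁻ (leafs n) t∈
... | inj₁ p = inj₁ p
... | inj₂ p = inj₂ (∈-++⁻ (rooted k asc n) p)

HasRoot : Sign → Tree → Set
HasRoot s t = ∃₂ λ l r → t ≡ node s l r

∈-rooted⁻ : ∀ k s n {t} → t ∈ rooted k s n → HasRoot s t × nodes t ≡ n × Canonical t
∈-trees⁻  : ∀ k n {t} → t ∈ trees k n → nodes t ≡ n × Canonical t
∈-notRooted⁻ : ∀ k s n {t} → t ∈ notRooted k s n → NotRooted s t × nodes t ≡ n × Canonical t

∈-rooted⁻ (suc k) s (suc n) t∈
  with i , j , l , r , refl , l∈ , r∈ , refl ← ∈-convolve⁻ (node s) (trees k) (notRooted k s) n t∈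
  with refl , cl ← ∈-trees⁻ k i l∈ | nr , refl , cr ← ∈-notRooted⁻ k s j r∈
  = (l , r , refl) , refl , node cl cr nr

∈-trees⁻ k n t∈ with ∈-trees⁻′ k n t∈
... | inj₁ p with refl , eq ← ∈-leafs⁻ n p = eq , leaf
... | inj₂ (inj₁ p) = proj₂ (∈-rooted⁻ k asc n p)
... | inj₂ (inj₂ p) = proj₂ (∈-rooted⁻ k dsc n p)

∈-notRooted⁻ k s n t∈ with ∈-++⁻ (leafs n) t∈
... | inj₁ p with refl , eq ← ∈-leafs⁻ n p = tt , eq , leaf
... | inj₂ p with (_ , _ , refl) , rest ← ∈-rooted⁻ k (opposite s) n p = refl , rest

∈-trees-node⁺ : ∀ k s n {t} → t ∈ rooted k s n → t ∈ trees k n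
∈-trees-node⁺ k asc n p = ∈-++⁺ʳ (leafs n) (∈-++⁺ˡ p)
∈-trees-node⁺ k dsc n p = ∈-++⁺ʳ (leafs n) (∈-++⁺ʳ (rooted k asc n) p)

∈-rooted⁺ : ∀ k {s l r} → nodes (node s l r) ℕ.≤ k → Canonical (node s l r) →
            node s l r ∈ rooted k s (nodes (node s l r))
∈-trees⁺ : ∀ k {t} → nodes t ℕ.≤ k → Canonical t → t ∈ trees k (nodes t)
∈-notRooted⁺ : ∀ k s {t} → nodes t ℕ.≤ k → Canonical t → NotRooted s t → t ∈ notRooted k s (nodes t)

∈-rooted⁺ (suc k) {s} {l} {r} (s≤s le) (node cl cr nr) =
  ∈-convolve⁺ (node s) (trees k) (notRooted k s) (nodes l) (nodes r)
    (∈-trees⁺ k (ℕ.m+n≤o⇒m≤o (nodes l) le) cl)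
    (∈-notRooted⁺ k s (ℕ.m+n≤o⇒n≤o (nodes l) le) cr nr)

∈-trees⁺ k {leaf}       le c = here refl
∈-trees⁺ k {node s l r} le c = ∈-trees-node⁺ k s _ (∈-rooted⁺ k le c)

∈-notRooted⁺ k s {leaf}        le c nr   = here refl
∈-notRooted⁺ k s {node _ l r}  le c refl = ∈-++⁺ʳ _ (∈-rooted⁺ k le c)

node-injective : ∀ {s : Sign} {l l′ r r′ : Tree} → Tree.node s l r ≡ node s l′ r′ → l ≡ l′ × r ≡ r′
node-injective refl = refl , refl

leafs-unique : ∀ n → Unique (leafs n)
leafs-unique zero    = ListAll.[] ListAllPairs.∷ ListAllPairs.[]
leafs-unique (suc n) = ListAllPairs.[]

rooted-unique : ∀ k s n → Unique (rooted k s n)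
trees-unique : ∀ k n → Unique (trees k n)
notRooted-unique : ∀ k s n → Unique (notRooted k s n)

rooted-unique zero    s n       = ListAllPairs.[]
rooted-unique (suc k) s zero    = ListAllPairs.[]
rooted-unique (suc k) s (suc n) = convolve-unique (node s) (trees k) (notRooted k s) n node-injective
  (λ p q → trans (sym (proj₁ (∈-trees⁻ k _ p))) (proj₁ (∈-trees⁻ k _ q)))
  (trees-unique k) (notRooted-unique k s)

trees-unique k n = Unique.++⁺ (leafs-unique n)
  (Unique.++⁺ (rooted-unique k asc n) (rooted-unique k dsc n) disjoint)
  λ (p , q) → leaf∉ (∈-leafs⁻ n p) (∈-++⁻ (rooted k asc n) q)
  where
  disjoint : Disjoint (rooted k asc n) (rooted k dsc n)
  disjoint (p , q) with (_ , _ , refl) , _ ← ∈-rooted⁻ k asc n p | (_ , _ , ()) , _ ← ∈-rooted⁻ k dsc n q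

  leaf∉ : ∀ {t} {X Y : Set} → t ≡ leaf × X → t ∈ rooted k asc n ⊎ t ∈ rooted k dsc n → Y
  leaf∉ (refl , _) (inj₁ q) with (_ , _ , ()) , _ ← ∈-rooted⁻ k asc n q
  leaf∉ (refl , _) (inj₂ q) with (_ , _ , ()) , _ ← ∈-rooted⁻ k dsc n q

notRooted-unique k s n = Unique.++⁺ (leafs-unique n) (rooted-unique k (opposite s) n)
  λ (p , q) → leaf∉ (∈-leafs⁻ n p) q
  where
  leaf∉ : ∀ {t} {X Y : Set} → t ≡ leaf × X → t ∈ rooted k (opposite s) n → Y
  leaf∉ (refl , _) q with (_ , _ , ()) , _ ← ∈-rooted⁻ k (opposite s) n q

-- Once the bound reaches n, membership amounts to root label, number of nodes and canonicity, none
-- of which mentions the bound.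
∑-rooted-bound : ∀ k s {n} f → n ℕ.≤ k → ∑ (rooted k s n) f ≡ ∑ (rooted n s n) f
∑-rooted-bound k s {n} f n≤k = ∑-set f (rooted-unique k s n) (rooted-unique n s n)
  (mk⇔ (resize k n ℕ.≤-refl) (resize n k n≤k))
  where
  resize : ∀ i j {t} → n ℕ.≤ j → t ∈ rooted i s n → t ∈ rooted j s n
  resize i j n≤j t∈ with (_ , _ , refl) , refl , c ← ∈-rooted⁻ i s n t∈ = ∈-rooted⁺ j n≤j c

∑-notRooted-bound : ∀ k s {n} f → n ℕ.≤ k → ∑ (notRooted k s n) f ≡ ∑ (notRooted n s n) f
∑-notRooted-bound k s {n} f n≤k = begin
  ∑ (notRooted k s n) f                       ≡⟨ ∑-++ (leafs n) _ f ⟩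
  ∑ (leafs n) f + ∑ (rooted k (opposite s) n) f ≡⟨ cong (λ z → ∑ (leafs n) f + z) (∑-rooted-bound k (opposite s) f n≤k) ⟩
  ∑ (leafs n) f + ∑ (rooted n (opposite s) n) f ≡⟨ ∑-++ (leafs n) _ f ⟨
  ∑ (notRooted n s n) f                       ∎

∑-trees : ∀ k n f → ∑ (trees k n) f ≡ ∑ (leafs n) f + ∑ (rooted k asc n) f + ∑ (rooted k dsc n) f
∑-trees k n f = begin
  ∑ (trees k n) f
    ≡⟨ ∑-++ (leafs n) _ f ⟩
  ∑ (leafs n) f + ∑ (rooted k asc n ++ rooted k dsc n) f
    ≡⟨ cong (λ z → ∑ (leafs n) f + z) (∑-++ (rooted k asc n) _ f) ⟩
  ∑ (leafs n) f + (∑ (rooted k asc n) f + ∑ (rooted k dsc n) f)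
    ≡⟨ ℤ.+-assoc (∑ (leafs n) f) _ _ ⟨
  ∑ (leafs n) f + ∑ (rooted k asc n) f + ∑ (rooted k dsc n) f ∎

∑-trees-bound : ∀ k {n} f → n ℕ.≤ k → ∑ (trees k n) f ≡ ∑ (trees n n) f
∑-trees-bound k {n} f n≤k = begin
  ∑ (trees k n) f
    ≡⟨ ∑-trees k n f ⟩
  ∑ (leafs n) f + ∑ (rooted k asc n) f + ∑ (rooted k dsc n) f
    ≡⟨ cong₂ (λ a b → ∑ (leafs n) f + a + b) (∑-rooted-bound k asc f n≤k) (∑-rooted-bound k dsc f n≤k) ⟩
  ∑ (leafs n) f + ∑ (rooted n asc n) f + ∑ (rooted n dsc n) f
    ≡⟨ ∑-trees n n f ⟨
  ∑ (trees n n) f ∎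

-- A weight that factors over the two subtrees turns the convolution of lists into a product of
-- series. The common bound n may be replaced by the individual sizes because only sizes up to n
-- enter coefficient n.
∑-rooted : ∀ s n (f g h : Tree → ℤ) → (∀ l r → f (node s l r) ≡ g l * h r) →
  ∑ (rooted (suc n) s (suc n)) f ≡ ((λ i → ∑ (trees i i) g) ⊛ (λ j → ∑ (notRooted j s j) h)) n
∑-rooted s n f g h p = trans
  (∑-convolve (node s) (trees n) (notRooted n s) n f g h p)
  (⊛-cong-≤ n (∑-trees-bound n g) (∑-notRooted-bound n s h))

-- Weights of label words

weight : Sign → ℤ
weight asc = 1ℤ
weight dsc = -1ℤ

sgn : List Sign → ℤ
sgn []      = 1ℤ
sgn (s ∷ w) = weight s * sgn w

sgn-++ : ∀ u s v → sgn (u ++ s ∷ v) ≡ sgn u * (weight s * sgn v)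
sgn-++ []      s v = sym (ℤ.*-identityˡ _)
sgn-++ (x ∷ u) s v = trans (cong (weight x *_) (sgn-++ u s v)) (sym (ℤ.*-assoc (weight x) (sgn u) _))

δ : Sign → Sign → ℤ
δ asc asc = 1ℤ
δ asc dsc = 0ℤ
δ dsc asc = 0ℤ
δ dsc dsc = 1ℤ

-- The indicator of the words that alternate beginning with c, as an integer product so that it
-- factors over inorder words.
altFrom : Sign → List Sign → ℤ
altFrom c []      = 1ℤ
altFrom c (s ∷ w) = δ c s * altFrom (opposite c) w

-- The letter expected at 0-based position n of an alternating word that begins with c.
flips : ℕ → Sign → Sign
flips zero    c = c
flips (suc n) c = flips n (opposite c)

-- The middle factor vanishes unless s is the expected letter, so the rest may be required to begin
-- with `opposite s`, independently of u.
altFrom-++ : ∀ c u s v → altFrom c (u ++ s ∷ v) ≡ altFrom c u * δ (flips (length u) c) s * altFrom (opposite s) v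
altFrom-++ asc []      asc v = refl
altFrom-++ asc []      dsc v = refl
altFrom-++ dsc []      asc v = refl
altFrom-++ dsc []      dsc v = refl
altFrom-++ c   (x ∷ u) s   v rewrite altFrom-++ (opposite c) u s v =
  solve 4 (λ d e f g → d :* (e :* f :* g) := d :* e :* f :* g)
    refl (δ c x) (altFrom (opposite c) u) (δ (flips (length u) (opposite c)) s) (altFrom (opposite s) v)

-- The letter expected at position n is c exactly for even n, so the delta cuts out the even part;
-- with `opposite c` it cuts out the odd part.
δ-flips-same : ∀ c (f : Series) n → f n * δ (flips n c) c ≡ evenPart f n
δ-flips-same asc f zero          = ℤ.*-identityʳ (f 0)
δ-flips-same dsc f zero          = ℤ.*-identityʳ (f 0)
δ-flips-same asc f (suc zero)    = ℤ.*-zeroʳ (f 1)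
δ-flips-same dsc f (suc zero)    = ℤ.*-zeroʳ (f 1)
δ-flips-same asc f (suc (suc n)) = δ-flips-same asc (f ∘ ℕ.suc ∘ ℕ.suc) n
δ-flips-same dsc f (suc (suc n)) = δ-flips-same dsc (f ∘ ℕ.suc ∘ ℕ.suc) n

δ-flips-opposite : ∀ c (f : Series) n → f n * δ (flips n c) (opposite c) ≡ oddPart f n
δ-flips-opposite asc f zero    = ℤ.*-zeroʳ (f 0)
δ-flips-opposite dsc f zero    = ℤ.*-zeroʳ (f 0)
δ-flips-opposite asc f (suc n) = δ-flips-same dsc (f ∘ suc) n
δ-flips-opposite dsc f (suc n) = δ-flips-same asc (f ∘ suc) n

-- The signed and the alternating series

signedCount : Series
signedCount n = ∑ (trees n n) (sgn ∘ inorder)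

altCount : Sign → Series
altCount c n = ∑ (trees n n) (altFrom c ∘ inorder)

-- T, P and N are `signedCount`, `part asc` and `part dsc`. The weight of the root is assigned to
-- the left factor and then pulled out as a scalar.
signedCount-signed : Signed signedCount
signedCount-signed = signed-system signedCount (part asc) (part dsc)
  (λ n → trans (∑-trees n n (sgn ∘ inorder)) (cong (λ z → z + part asc n + part dsc n) (leafPart n)))
  partAsc partDsc
  where
  part : Sign → Series
  part s n = ∑ (rooted n s n) (sgn ∘ inorder)

  leafPart : ∀ n → ∑ (leafs n) (sgn ∘ inorder) ≡ 𝟙 n
  leafPart zero    = refl
  leafPart (suc n) = refl

  ∑-notRooted : ∀ s → (λ n → ∑ (notRooted n s n) (sgn ∘ inorder)) ≗ 𝟙 ⊞ part (opposite s)
  ∑-notRooted s n = trans (∑-++ (leafs n) _ (sgn ∘ inorder)) (cong (_+ part (opposite s) n) (leafPart n))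

  part-suc : ∀ s n → part s (suc n) ≡ weight s * (signedCount ⊛ (𝟙 ⊞ part (opposite s))) n
  part-suc s n = begin
    part s (suc n)
      ≡⟨ ∑-rooted s n (sgn ∘ inorder) (λ l → weight s * sgn (inorder l)) (sgn ∘ inorder)
           (λ l r → trans (sgn-++ (inorder l) s (inorder r)) (swap (sgn (inorder l)) (weight s) (sgn (inorder r)))) ⟩
    ((λ i → ∑ (trees i i) (λ l → weight s * sgn (inorder l))) ⊛ _) n
      ≡⟨ ⊛-cong (λ i → ∑-*ˡ (weight s) (trees i i) (sgn ∘ inorder)) (∑-notRooted s) n ⟩
    ((λ i → weight s * signedCount i) ⊛ (𝟙 ⊞ part (opposite s))) n
      ≡⟨ ⊛-scaleˡ (weight s) signedCount _ n ⟩
    weight s * (signedCount ⊛ (𝟙 ⊞ part (opposite s))) n ∎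
    where
    swap : ∀ a b c → a * (b * c) ≡ b * a * c
    swap = solve 3 (λ a b c → a :* (b :* c) := b :* a :* c) refl

  partAsc : part asc ≗ shift (signedCount ⊛ (𝟙 ⊞ part dsc))
  partAsc zero    = refl
  partAsc (suc n) = trans (part-suc asc n) (ℤ.*-identityˡ _)

  partDsc : part dsc ≗ -_ ∘ shift (signedCount ⊛ (𝟙 ⊞ part asc))
  partDsc zero    = refl
  partDsc (suc n) = trans (part-suc dsc n) (ℤ.-1*i≡-i _)

-- The series Q. For c = `opposite s` the list is `notRooted n s n`: it weighs the admissible right
-- subtrees of a node labelled s, whose words have to begin with `opposite s`.
altInit : Sign → Series
altInit c n = ∑ (leafs n ++ rooted n c n) (altFrom c ∘ inorder)

-- A left subtree with i nodes puts the root at position i of the inorder word. The expected label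
-- thus depends on i alone, and its delta leaves the sum over left subtrees.
alt-rooted : ∀ c s n → ∑ (rooted (suc n) s (suc n)) (altFrom c ∘ inorder) ≡
  ((λ i → altCount c i * δ (flips i c) s) ⊛ altInit (opposite s)) n
alt-rooted c s n = trans
  (∑-rooted s n (altFrom c ∘ inorder) left (altFrom (opposite s) ∘ inorder) (λ l r →
    trans (altFrom-++ c (inorder l) s (inorder r))
          (cong (λ k → altFrom c (inorder l) * δ (flips k c) s * altFrom (opposite s) (inorder r)) (length-inorder l))))
  (⊛-cong ∑-left (λ _ → refl) n)
  where
  left : Tree → ℤ
  left l = altFrom c (inorder l) * δ (flips (nodes l) c) s

  ∑-left : ∀ i → ∑ (trees i i) left ≡ altCount c i * δ (flips i c) s
  ∑-left i = begin
    ∑ (trees i i) left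
      ≡⟨ ∑-cong (trees i i) left _ (λ {l} l∈ →
           trans (ℤ.*-comm (altFrom c (inorder l)) (δ (flips (nodes l) c) s))
                 (cong (λ k → δ (flips k c) s * altFrom c (inorder l)) (proj₁ (∈-trees⁻ i i l∈)))) ⟩
    ∑ (trees i i) (λ l → δ (flips i c) s * altFrom c (inorder l))
      ≡⟨ ∑-*ˡ (δ (flips i c) s) (trees i i) (altFrom c ∘ inorder) ⟩
    δ (flips i c) s * altCount c i
      ≡⟨ ℤ.*-comm (δ (flips i c) s) _ ⟩
    altCount c i * δ (flips i c) s ∎

-- A root carrying the initial letter c must stand at an even 0-based position, so its left subtree
-- has an even number of nodes.
altInit-system : ∀ c → altInit c ≗ 𝟙 ⊞ shift (evenPart (altCount c) ⊛ altInit (opposite c))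
altInit-system c zero    = refl
altInit-system c (suc n) = begin
  altInit c (suc n)
    ≡⟨ alt-rooted c c n ⟩
  ((λ i → altCount c i * δ (flips i c) c) ⊛ altInit (opposite c)) n
    ≡⟨ ⊛-cong (δ-flips-same c (altCount c)) (λ _ → refl) n ⟩
  (evenPart (altCount c) ⊛ altInit (opposite c)) n
    ≡⟨ ℤ.+-identityˡ _ ⟨
  0ℤ + (evenPart (altCount c) ⊛ altInit (opposite c)) n ∎

altCount-split : ∀ c n → altCount c n ≡ altInit c n + ∑ (rooted n (opposite c) n) (altFrom c ∘ inorder)
altCount-split asc n = trans (∑-trees n n f) (cong (_+ ∑ (rooted n dsc n) f) (sym (∑-++ (leafs n) _ f)))
  where
  f : Tree → ℤ
  f = altFrom asc ∘ inorder
altCount-split dsc n = begin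
  altCount dsc n
    ≡⟨ ∑-trees n n f ⟩
  ∑ (leafs n) f + ∑ (rooted n asc n) f + ∑ (rooted n dsc n) f
    ≡⟨ solve 3 (λ x y z → x :+ y :+ z := x :+ z :+ y)
         refl (∑ (leafs n) f) (∑ (rooted n asc n) f) (∑ (rooted n dsc n) f) ⟩
  ∑ (leafs n) f + ∑ (rooted n dsc n) f + ∑ (rooted n asc n) f
    ≡⟨ cong (_+ ∑ (rooted n asc n) f) (∑-++ (leafs n) _ f) ⟨
  altInit dsc n + ∑ (rooted n asc n) f ∎
  where
  f : Tree → ℤ
  f = altFrom dsc ∘ inorder

-- A root labelled `opposite c` stands at an odd position, whence the odd part. The double
-- `opposite` comes from the right subtree of such a root; it reduces once c is a concrete sign.
altCount-system : ∀ c → altCount c ≗ altInit c ⊞ shift (oddPart (altCount c) ⊛ altInit (opposite (opposite c)))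
altCount-system c zero    = altCount-split c zero
altCount-system c (suc n) = trans (altCount-split c (suc n)) (cong (λ z → altInit c (suc n) + z)
  (trans (alt-rooted c (opposite c) n) (⊛-cong (δ-flips-opposite c (altCount c)) (λ _ → refl) n)))

-- The two systems arise from each other by exchanging the signs, and each determines its
-- coefficients successively. The symmetry closes the system for asc, where Q would otherwise occur
-- for both initial letters.
alt-symmetric : ∀ n → altCount asc n ≡ altCount dsc n × altInit asc n ≡ altInit dsc n
alt-symmetric = <-rec _ step
  where
  step : ∀ n → (∀ {i} → i ℕ.< n → altCount asc i ≡ altCount dsc i × altInit asc i ≡ altInit dsc i) →
         altCount asc n ≡ altCount dsc n × altInit asc n ≡ altInit dsc n
  step zero    ih = refl , refl
  step (suc n) ih = count≡ , init≡
    where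
    init≡ : altInit asc (suc n) ≡ altInit dsc (suc n)
    init≡ = begin
      altInit asc (suc n)
        ≡⟨ altInit-system asc (suc n) ⟩
      0ℤ + (evenPart (altCount asc) ⊛ altInit dsc) n
        ≡⟨ cong (λ z → 0ℤ + z) (⊛-cong-≤ n
             (λ {i} i≤n → evenPart-cong-≤ i (λ j≤i → proj₁ (ih (s≤s (ℕ.≤-trans j≤i i≤n)))))
             (λ i≤n → sym (proj₂ (ih (s≤s i≤n))))) ⟩
      0ℤ + (evenPart (altCount dsc) ⊛ altInit asc) n
        ≡⟨ altInit-system dsc (suc n) ⟨
      altInit dsc (suc n) ∎

    count≡ : altCount asc (suc n) ≡ altCount dsc (suc n)
    count≡ = begin
      altCount asc (suc n)
        ≡⟨ altCount-system asc (suc n) ⟩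
      altInit asc (suc n) + (oddPart (altCount asc) ⊛ altInit asc) n
        ≡⟨ cong₂ _+_ init≡ (⊛-cong-≤ n
             (λ {i} i≤n → oddPart-cong-≤ i (λ j≤i → proj₁ (ih (s≤s (ℕ.≤-trans j≤i i≤n)))))
             (λ i≤n → proj₂ (ih (s≤s i≤n)))) ⟩
      altInit dsc (suc n) + (oddPart (altCount dsc) ⊛ altInit dsc) n
        ≡⟨ altCount-system dsc (suc n) ⟨
      altCount dsc (suc n) ∎

signedCount≗dilate : signedCount ≗ dilate (evens (altCount asc))
signedCount≗dilate = signed-unique signedCount-signed (dilate-signed (proj₁ system) (proj₂ system))
  where
  system : (evens (altCount asc) 0 ≡ 1ℤ) × (∀ n → evens (altCount asc) (suc n) ≡ cubic (evens (altCount asc)) n)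
  system = alternating-system (altCount asc) (altInit asc)
    (λ n → trans (altInit-system asc n) (cong (λ z → 𝟙 n + z) (symmetric n)))
    (altCount-system asc)
    where
    symmetric : shift (evenPart (altCount asc) ⊛ altInit dsc) ≗ shift (evenPart (altCount asc) ⊛ altInit asc)
    symmetric zero    = refl
    symmetric (suc n) = ⊛-cong {f = evenPart (altCount asc)} (λ _ → refl) (sym ∘ proj₂ ∘ alt-symmetric) n

-- Lists ordered up to a sign

infix 4 _<[_]_ _≺[_]_

-- Reversing the order by a sign lets one argument serve both orders of blocks and both patterns,
-- which are complements of each other.
_<[_]_ : ℕ → Sign → ℕ → Set
a <[ asc ] b = a < b
a <[ dsc ] b = b < a

_<[_]?_ : ∀ a s b → Dec (a <[ s ] b)
a <[ asc ]? b = a ℕ.<? b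
a <[ dsc ]? b = b ℕ.<? a

<[]-trans : ∀ s {a b c} → a <[ s ] b → b <[ s ] c → a <[ s ] c
<[]-trans asc p q = ℕ.<-trans p q
<[]-trans dsc p q = ℕ.<-trans q p

<[]-asym : ∀ s {a b} → a <[ s ] b → ¬ b <[ s ] a
<[]-asym asc = ℕ.<-asym
<[]-asym dsc = ℕ.<-asym

<[]-opposite : ∀ s {a b} → a <[ s ] b → b <[ opposite s ] a
<[]-opposite asc p = p
<[]-opposite dsc p = p

<[]-connex : ∀ s {a b} → a ≢ b → a <[ s ] b ⊎ b <[ s ] a
<[]-connex s {a} {b} a≢b with ℕ.<-cmp a b
<[]-connex asc a≢b | tri< p _ _ = inj₁ p
<[]-connex dsc a≢b | tri< p _ _ = inj₂ p
<[]-connex s   a≢b | tri≈ _ p _ = contradiction p a≢b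
<[]-connex asc a≢b | tri> _ _ p = inj₂ p
<[]-connex dsc a≢b | tri> _ _ p = inj₁ p

<[]-sign : ∀ {s s′ a b} → a <[ s ] b → a <[ s′ ] b → s ≡ s′
<[]-sign {asc} {asc} p q = refl
<[]-sign {asc} {dsc} p q = contradiction q (ℕ.<-asym p)
<[]-sign {dsc} {asc} p q = contradiction q (ℕ.<-asym p)
<[]-sign {dsc} {dsc} p q = refl

_≺[_]_ : List ℕ → Sign → List ℕ → Set
u ≺[ s ] v = ∀ {a b} → a ∈ u → b ∈ v → a <[ s ] b

-- The pattern is 3142 for s = asc and 2413 for s = dsc.

Avoiding : List ℕ → Set
Avoiding w = ∀ s {a b c d} → a ∷ b ∷ c ∷ d ∷ [] ⊆ w → b <[ s ] d → d <[ s ] a → a <[ s ] c → ⊥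

Avoiding-⊆ : ∀ {u w} → u ⊆ w → Avoiding w → Avoiding u
Avoiding-⊆ τ av s σ = av s (Sub.⊆-trans σ τ)

Unique-⊆ : ∀ {u w : List A} → u ⊆ w → Unique w → Unique u
Unique-⊆ []         ListAllPairs.[]        = ListAllPairs.[]
Unique-⊆ (y ∷ʳ τ)   (_ ListAllPairs.∷ w!)  = Unique-⊆ τ w!
Unique-⊆ (refl ∷ τ) (y∉ ListAllPairs.∷ w!) = Sub.All-resp-⊆ τ y∉ ListAllPairs.∷ Unique-⊆ τ w!

⊆-++ˡ : ∀ (u v : List A) → u ⊆ u ++ v
⊆-++ˡ u v = Sub.++⁺ʳ v Sub.⊆-refl

⊆-++ʳ : ∀ (u v : List A) → v ⊆ u ++ v
⊆-++ʳ u v = Sub.++⁺ˡ u Sub.⊆-refl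

++-⊆-split : ∀ (u : List A) {v w} → w ⊆ u ++ v → ∃₂ λ w₁ w₂ → w ≡ w₁ ++ w₂ × w₁ ⊆ u × w₂ ⊆ v
++-⊆-split []      τ = [] , _ , refl , [] , τ
++-⊆-split (x ∷ u) (.x ∷ʳ τ) =
  let w₁ , w₂ , eq , σ , ρ = ++-⊆-split u τ in w₁ , w₂ , eq , x ∷ʳ σ , ρ
++-⊆-split (x ∷ u) (refl ∷ τ) =
  let w₁ , w₂ , eq , σ , ρ = ++-⊆-split u τ in x ∷ w₁ , w₂ , cong (x ∷_) eq , refl ∷ σ , ρ

-- Neither pattern splits into a prefix entirely below or entirely above the rest. If an occurrence
-- straddles the border, one comparison across it forces the two signs to agree, and another then
-- contradicts the pattern.
++-Avoiding : ∀ s {u v} → u ≺[ s ] v → Avoiding u → Avoiding v → Avoiding (u ++ v)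
++-Avoiding s {u} u≺v avu avv s′ {a} {b} {c} {d} τ b<d d<a a<c with ++-⊆-split u τ
... | [] , _ , refl , σ , ρ = avv s′ ρ b<d d<a a<c
... | _ ∷ [] , _ , refl , σ , ρ
      with refl ← <[]-sign {s} {s′} (u≺v (Sub.lookup σ (here refl)) (Sub.lookup ρ (there (here refl)))) a<c
      = <[]-asym s (<[]-trans s b<d d<a) (u≺v (Sub.lookup σ (here refl)) (Sub.lookup ρ (here refl)))
... | _ ∷ _ ∷ [] , _ , refl , σ , ρ
      with refl ← <[]-sign {s} {s′} (u≺v (Sub.lookup σ (here refl)) (Sub.lookup ρ (here refl))) a<c
      = <[]-asym s d<a (u≺v (Sub.lookup σ (here refl)) (Sub.lookup ρ (there (here refl))))
... | _ ∷ _ ∷ _ ∷ [] , _ , refl , σ , ρ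
      with refl ← <[]-sign {s} {s′} (u≺v (Sub.lookup σ (there (here refl))) (Sub.lookup ρ (here refl))) b<d
      = <[]-asym s d<a (u≺v (Sub.lookup σ (here refl)) (Sub.lookup ρ (here refl)))
... | _ ∷ _ ∷ _ ∷ _ ∷ [] , [] , refl , σ , ρ = avu s′ σ b<d d<a a<c

-- Decomposition of separable words

-- Only one split is recorded; the explicit heads make both blocks nonempty.
data Decomposition : List ℕ → Set where
  single : ∀ x → Decomposition [ x ]
  split  : ∀ s a u b v → (a ∷ u) ≺[ s ] (b ∷ v) → Decomposition ((a ∷ u) ++ (b ∷ v))

-- The first letter above x decides: a later letter below x yields an inverted pair, and otherwise v
-- is cut just before that first letter.
cut : ∀ s x v → x ∉ v →
  (∃₂ λ l h → v ≡ l ++ h × (∀ {a} → a ∈ l → a <[ s ] x) × (∀ {b} → b ∈ h → x <[ s ] b)) ⊎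
  (∃₂ λ h l → h ∷ l ∷ [] ⊆ v × x <[ s ] h × l <[ s ] x)
cut s x []      x∉ = inj₁ ([] , [] , refl , (λ ()) , λ ())
cut s x (y ∷ v) x∉ with <[]-connex s (x∉ ∘ here)
... | inj₂ y<x with cut s x v (x∉ ∘ there)
...   | inj₁ (l , h , eq , l<x , x<h) =
        inj₁ (y ∷ l , h , cong (y ∷_) eq , (λ { (here refl) → y<x ; (there p) → l<x p }) , x<h)
...   | inj₂ (h , l , τ , x<h , l<x) = inj₂ (h , l , y ∷ʳ τ , x<h , l<x)
cut s x (y ∷ v) x∉ | inj₁ x<y with Any.any? (λ b → b <[ s ]? x) v
... | yes p = let l , l∈ , l<x = find p in inj₂ (y , l , refl ∷ Sub.from∈ l∈ , x<y , l<x)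
... | no ¬p = inj₁ ([] , y ∷ v , refl , (λ ()) , λ { (here refl) → x<y ; (there b∈) → above b∈ })
  where
  above : ∀ {b} → b ∈ v → x <[ s ] b
  above b∈ with <[]-connex s (λ { refl → x∉ (there b∈) })
  ... | inj₁ x<b = x<b
  ... | inj₂ b<x = contradiction (Any.map (λ { refl → b<x }) b∈) ¬p

-- If w = u ++ v with u below v, the letters of v below x must precede those above it: otherwise
-- x, a letter of u, and an inverted pair of v form 3142 (2413 when the order is reversed).

extend : ∀ x {w} → Decomposition w → Unique (x ∷ w) → Avoiding (x ∷ w) → Decomposition (x ∷ w)
extend x (single y) x! av with <[]-connex asc {x} {y} (λ { refl → Unique.Unique[x∷xs]⇒x∉xs x! (here refl) })
... | inj₁ x<y = split asc x [] y [] λ { (here refl) (here refl) → x<y }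
... | inj₂ y<x = split dsc x [] y [] λ { (here refl) (here refl) → y<x }
extend x (split s a u b v u≺v) x! av
  with cut s x (b ∷ v) (Unique.Unique[x∷xs]⇒x∉xs x! ∘ ∈-++⁺ʳ (a ∷ u))
... | inj₂ (h , l , τ , x<h , l<x) =
  ⊥-elim (av s (refl ∷ refl ∷ Sub.++⁺ˡ u τ) (u≺v (here refl) (Sub.lookup τ (there (here refl)))) l<x x<h)
-- The whole second block is below x, hence so is the first one, and x alone splits off in the
-- opposite order.
... | inj₁ (l , [] , eq , l<x , _) = split (opposite s) x [] a (u ++ b ∷ v)
  λ { (here refl) q∈ → <[]-opposite s (below (∈-++⁻ (a ∷ u) q∈)) }
  where
  v<x : ∀ {q} → q ∈ b ∷ v → q <[ s ] x
  v<x q∈ = l<x (subst (_ ∈_) (trans eq (List.++-identityʳ l)) q∈)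

  below : ∀ {q} → q ∈ a ∷ u ⊎ q ∈ b ∷ v → q <[ s ] x
  below (inj₁ q∈) = <[]-trans s (u≺v q∈ (here refl)) (v<x (here refl))
  below (inj₂ q∈) = v<x q∈
-- The letters above x form the new last block; x, the old first block and the letters l all lie
-- below them.
... | inj₁ (l , c ∷ h , eq , l<x , x<h) =
  subst Decomposition
    (trans (cong (x ∷_) (List.++-assoc (a ∷ u) l (c ∷ h))) (cong (λ z → x ∷ (a ∷ u) ++ z) (sym eq)))
    (split s x ((a ∷ u) ++ l) c h λ p q → ordered p (subst (_ ∈_) (sym eq) (∈-++⁺ʳ l q)) q)
  where
  ordered : ∀ {p q} → p ∈ x ∷ (a ∷ u) ++ l → q ∈ b ∷ v → q ∈ c ∷ h → p <[ s ] q
  ordered (here refl) _  q∈ = x<h q∈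
  ordered (there p∈)  q∈v q∈ with ∈-++⁻ (a ∷ u) p∈
  ... | inj₁ p∈u = u≺v p∈u q∈v
  ... | inj₂ p∈l = <[]-trans s (l<x p∈l) (x<h q∈)

decompose : ∀ x w → Unique (x ∷ w) → Avoiding (x ∷ w) → Decomposition (x ∷ w)
decompose x []      x! av = single x
decompose x (y ∷ w) x! av =
  extend x (decompose y w (Unique-⊆ (x ∷ʳ Sub.⊆-refl) x!) (Avoiding-⊆ (x ∷ʳ Sub.⊆-refl) av)) x! av

-- Levi's lemma: of two prefixes of one list, the longer extends the shorter.
++-overlap : ∀ (u u′ : List A) {v v′} → u ++ v ≡ u′ ++ v′ →
  (∃ λ z → u′ ≡ u ++ z × v ≡ z ++ v′) ⊎ (∃ λ z → u ≡ u′ ++ z × v′ ≡ z ++ v)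
++-overlap []      u′       eq = inj₁ (u′ , refl , eq)
++-overlap (x ∷ u) []       eq = inj₂ (x ∷ u , refl , sym eq)
++-overlap (x ∷ u) (y ∷ u′) eq with refl , eq′ ← List.∷-injective eq with ++-overlap u u′ eq′
... | inj₁ (z , p , q) = inj₁ (z , cong (x ∷_) p , q)
... | inj₂ (z , p , q) = inj₂ (z , cong (x ∷_) p , q)

NonEmpty : List A → Set
NonEmpty w = ∃ λ x → x ∈ w

∈-head : ∀ (u u′ : List A) {v v′} → u ++ v ≡ u′ ++ v′ → NonEmpty u → NonEmpty u′ → ∃ λ x → x ∈ u × x ∈ u′
∈-head []      u′       eq (_ , ()) _
∈-head (x ∷ u) []       eq _        (_ , ())
∈-head (x ∷ u) (y ∷ u′) eq _ _ with refl , _ ← List.∷-injective eq = x , here refl , here refl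

-- Both first blocks contain the first letter, and the shorter of the two last blocks lies inside
-- the longer. One pair of letters is therefore compared by both splits.
split-sign : ∀ {s s′} u u′ {v v′} → u ++ v ≡ u′ ++ v′ → NonEmpty u → NonEmpty u′ → NonEmpty v → NonEmpty v′ →
             u ≺[ s ] v → u′ ≺[ s′ ] v′ → s ≡ s′
split-sign u u′ eq u≢ u′≢ (b , b∈) (b′ , b′∈) p p′ with ∈-head u u′ eq u≢ u′≢ | ++-overlap u u′ eq
... | a , a∈ , a∈′ | inj₁ (z , _ , refl) = <[]-sign (p a∈ (∈-++⁺ʳ z b′∈)) (p′ a∈′ b′∈)
... | a , a∈ , a∈′ | inj₂ (z , _ , refl) = <[]-sign (p a∈ b∈) (p′ a∈′ (∈-++⁺ʳ z b∈))

-- Words filling an interval of values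

Within : ℕ → ℕ → List ℕ → Set
Within lo hi w = ∀ {a} → a ∈ w → lo ≤ a × a < hi

lookup-injective : ∀ {w : List A} → Unique w → ∀ i j → List.lookup w i ≡ List.lookup w j → i ≡ j
lookup-injective {w = x ∷ w} w! zero zero eq = refl
lookup-injective {w = x ∷ w} w! zero (suc j) eq =
  contradiction (subst (_∈ w) (sym eq) (∈-lookup j)) (Unique.Unique[x∷xs]⇒x∉xs w!)
lookup-injective {w = x ∷ w} w! (suc i) zero eq =
  contradiction (subst (_∈ w) eq (∈-lookup i)) (Unique.Unique[x∷xs]⇒x∉xs w!)
lookup-injective {w = x ∷ w} (_ ListAllPairs.∷ w!) (suc i) (suc j) eq = cong suc (lookup-injective w! i j eq)

-- Subtracting lo embeds the positions of w into `Fin (hi ∸ lo)`. For empty w the conclusion is the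
-- hypothesis `lo ≤ hi` itself.
pigeonhole : ∀ {lo hi w} → lo ≤ hi → Unique w → Within lo hi w → lo ℕ.+ length w ≤ hi
pigeonhole {lo} {hi} {w} lo≤hi w! within =
  subst (lo ℕ.+ length w ≤_) (ℕ.m+[n∸m]≡n lo≤hi) (ℕ.+-monoʳ-≤ lo (Fin.injective⇒≤ {f = index} index-injective))
  where
  bound : ∀ i → List.lookup w i ∸ lo < hi ∸ lo
  bound i = let p , q = within (∈-lookup i) in ℕ.∸-monoˡ-< q p

  index : Fin (length w) → Fin (hi ∸ lo)
  index i = Fin.fromℕ< (bound i)

  index-injective : ∀ {i j} → index i ≡ index j → i ≡ j
  index-injective {i} {j} eq = lookup-injective w! i j
    (ℕ.∸-cancelʳ-≡ (proj₁ (within (∈-lookup i))) (proj₁ (within (∈-lookup j)))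
      (Fin.fromℕ<-injective _ _ (bound i) (bound j) eq))

-- The interval has just as many values as there are letters. By `pigeonhole`, all of h must fit
-- above any letter of l, and all of l below any letter of h.
blocks-within : ∀ o {l h} → l ≺[ asc ] h → Unique l → Unique h →
  Within o (o ℕ.+ (length l ℕ.+ length h)) l → Within o (o ℕ.+ (length l ℕ.+ length h)) h →
  Within o (o ℕ.+ length l) l × Within (o ℕ.+ length l) (o ℕ.+ length l ℕ.+ length h) h
blocks-within o {l} {h} l≺h l! h! wl wh = low , high
  where
  total : o ℕ.+ (length l ℕ.+ length h) ≡ o ℕ.+ length l ℕ.+ length h
  total = sym (ℕ.+-assoc o (length l) (length h))

  low : Within o (o ℕ.+ length l) l
  low {a} a∈ = proj₁ (wl a∈) , ℕ.+-cancelʳ-≤ (length h) (suc a) (o ℕ.+ length l)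
    (subst (suc a ℕ.+ length h ≤_) total
      (pigeonhole (proj₂ (wl a∈)) h! λ b∈ → l≺h a∈ b∈ , proj₂ (wh b∈)))

  high : Within (o ℕ.+ length l) (o ℕ.+ length l ℕ.+ length h) h
  high {b} b∈ =
      pigeonhole (proj₁ (wh b∈)) l! (λ a∈ → proj₁ (wl a∈) , l≺h a∈ b∈)
    , subst (b <_) total (proj₂ (wh b∈))

-- Words of trees

-- The values of a subtree start at o if it is the lower block, and otherwise after the values of
-- its sibling.
leftOffset rightOffset : Sign → ℕ → Tree → ℕ
leftOffset asc o r = o
leftOffset dsc o r = o ℕ.+ leaves r
rightOffset asc o l = o ℕ.+ leaves l
rightOffset dsc o l = o

word : ℕ → Tree → List ℕ
word o leaf         = [ o ]
word o (node s l r) = word (leftOffset s o r) l ++ word (rightOffset s o l) r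

length-word : ∀ o t → length (word o t) ≡ leaves t
length-word o leaf         = refl
length-word o (node s l r) = begin
  length (word (leftOffset s o r) l ++ word (rightOffset s o l) r)
    ≡⟨ List.length-++ (word (leftOffset s o r) l) ⟩
  length (word (leftOffset s o r) l) ℕ.+ length (word (rightOffset s o l) r)
    ≡⟨ cong₂ ℕ._+_ (length-word (leftOffset s o r) l) (length-word (rightOffset s o l) r) ⟩
  suc (nodes l ℕ.+ suc (nodes r))
    ≡⟨ cong suc (ℕ.+-suc (nodes l) (nodes r)) ⟩
  suc (suc (nodes l ℕ.+ nodes r)) ∎

length-word-injective : ∀ {o o′} t t′ → word o t ≡ word o′ t′ → nodes t ≡ nodes t′
length-word-injective {o} {o′} t t′ eq =
  ℕ.suc-injective (trans (sym (length-word o t)) (trans (cong length eq) (length-word o′ t′)))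

word-head : ∀ o t → ∃₂ λ a u → word o t ≡ a ∷ u
word-head o leaf         = o , [] , refl
word-head o (node s l r) =
  let a , u , eq = word-head (leftOffset s o r) l in a , _ , cong (_++ word (rightOffset s o l) r) eq

word-nonEmpty : ∀ o t → NonEmpty (word o t)
word-nonEmpty o t = let a , _ , eq = word-head o t in a , subst (a ∈_) (sym eq) (here refl)

leaves-node : ∀ o l r → o ℕ.+ leaves l ℕ.+ leaves r ≡ o ℕ.+ suc (suc (nodes l ℕ.+ nodes r))
leaves-node o l r = trans (ℕ.+-assoc o (leaves l) (leaves r)) (cong (λ k → o ℕ.+ suc k) (ℕ.+-suc (nodes l) (nodes r)))

word-within : ∀ o t → Within o (o ℕ.+ leaves t) (word o t)
word-within o leaf (here refl) = ℕ.≤-refl , ℕ.≤-reflexive (ℕ.+-comm 1 o)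
word-within o (node asc l r) {a} a∈ with ∈-++⁻ (word o l) a∈
... | inj₁ p = let lo , hi = word-within o l p in
  lo , ℕ.<-≤-trans hi (subst (o ℕ.+ leaves l ≤_) (leaves-node o l r) (ℕ.m≤m+n _ (leaves r)))
... | inj₂ p = let lo , hi = word-within (o ℕ.+ leaves l) r p in
  ℕ.≤-trans (ℕ.m≤m+n o (leaves l)) lo , subst (a <_) (leaves-node o l r) hi
word-within o (node dsc l r) {a} a∈ with ∈-++⁻ (word (o ℕ.+ leaves r) l) a∈
... | inj₁ p = let lo , hi = word-within (o ℕ.+ leaves r) l p in
  ℕ.≤-trans (ℕ.m≤m+n o (leaves r)) lo
  , subst (a <_) (trans (leaves-node o r l) (cong (λ k → o ℕ.+ suc (suc k)) (ℕ.+-comm (nodes r) (nodes l)))) hi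
... | inj₂ p = let lo , hi = word-within o r p in
  lo , ℕ.<-≤-trans hi (ℕ.+-monoʳ-≤ o (s≤s (ℕ.m≤n⇒m≤1+n (ℕ.m≤n+m (nodes r) (nodes l)))))

word-≺ : ∀ s o l r → word (leftOffset s o r) l ≺[ s ] word (rightOffset s o l) r
word-≺ asc o l r p q = ℕ.<-≤-trans (proj₂ (word-within o l p)) (proj₁ (word-within (o ℕ.+ leaves l) r q))
word-≺ dsc o l r p q = ℕ.<-≤-trans (proj₂ (word-within o r q)) (proj₁ (word-within (o ℕ.+ leaves r) l p))

word-unique : ∀ o t → Unique (word o t)
word-unique o leaf         = ListAll.[] ListAllPairs.∷ ListAllPairs.[]
word-unique o (node s l r) = Unique.++⁺ (word-unique (leftOffset s o r) l) (word-unique (rightOffset s o l) r)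
  λ (p , q) → <[]-asym s (word-≺ s o l r p q) (word-≺ s o l r p q)

word-avoiding : ∀ o t → Avoiding (word o t)
word-avoiding o leaf s (_ ∷ ())
word-avoiding o leaf s (_ ∷ʳ ())
word-avoiding o (node s l r) =
  ++-Avoiding s (word-≺ s o l r) (word-avoiding (leftOffset s o r) l) (word-avoiding (rightOffset s o l) r)

-- By `split-sign` every split of the word of a node has the sign of its root, and the word of a
-- leaf is too short to split.
notRooted-split : ∀ s o t u {v} → NotRooted s t → word o t ≡ u ++ v → NonEmpty u → NonEmpty v → ¬ u ≺[ s ] v
notRooted-split s o leaf [] nr eq (_ , ()) v≢ u≺v
notRooted-split s o leaf (x ∷ []) {[]} nr eq u≢ (_ , ()) u≺v
notRooted-split s o leaf (x ∷ y ∷ u) nr () u≢ v≢ u≺v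
notRooted-split s o leaf (x ∷ []) {y ∷ v} nr () u≢ v≢ u≺v
notRooted-split s o (node s′ l r) u refl eq u≢ v≢ u≺v = Sign.s≢opposite[s] s
  (sym (split-sign _ u eq (word-nonEmpty _ l) u≢ (word-nonEmpty _ r) v≢ (word-≺ s′ o l r) u≺v))

-- If one left block were longer, the surplus z would begin the other tree's right block and lie
-- before its remainder in the order s, against `notRooted-split`.
canonical-blocks : ∀ s o l l′ r r′ → NotRooted s r → NotRooted s r′ →
  word o (node s l r) ≡ word o (node s l′ r′) →
  word (leftOffset s o r) l ≡ word (leftOffset s o r′) l′ × word (rightOffset s o l) r ≡ word (rightOffset s o l′) r′
canonical-blocks s o l l′ r r′ nr nr′ eq
  with ++-overlap (word (leftOffset s o r) l) (word (leftOffset s o r′) l′) eq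
... | inj₁ ([] , pre , suf) = sym (trans pre (List.++-identityʳ _)) , suf
... | inj₂ ([] , pre , suf) = trans pre (List.++-identityʳ _) , sym suf
... | inj₁ (z@(_ ∷ _) , pre , suf) = ⊥-elim
  (notRooted-split s _ r z nr suf (_ , here refl) (word-nonEmpty _ r′)
    λ p q → word-≺ s o l′ r′ (subst (_ ∈_) (sym pre) (∈-++⁺ʳ (word _ l) p)) q)
... | inj₂ (z@(_ ∷ _) , pre , suf) = ⊥-elim
  (notRooted-split s _ r′ z nr′ suf (_ , here refl) (word-nonEmpty _ r)
    λ p q → word-≺ s o l r (subst (_ ∈_) (sym pre) (∈-++⁺ʳ (word _ l′) p)) q)

leftOffset-cong : ∀ s o r r′ → nodes r ≡ nodes r′ → leftOffset s o r ≡ leftOffset s o r′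
leftOffset-cong asc o r r′ eq = refl
leftOffset-cong dsc o r r′ eq = cong (λ k → o ℕ.+ suc k) eq

rightOffset-cong : ∀ s o l l′ → nodes l ≡ nodes l′ → rightOffset s o l ≡ rightOffset s o l′
rightOffset-cong asc o l l′ eq = cong (λ k → o ℕ.+ suc k) eq
rightOffset-cong dsc o l l′ eq = refl

-- The root label is recovered by `split-sign` and the blocks by `canonical-blocks`. The offset of a
-- subtree may involve the size of its sibling, which the length of the sibling's word reveals.
word-injective : ∀ o {t t′} → Canonical t → Canonical t′ → word o t ≡ word o t′ → t ≡ t′
word-injective o leaf leaf eq = refl
word-injective o leaf (node {s} {l} {r} _ _ _) eq with () ← length-word-injective leaf (node s l r) eq
word-injective o (node {s} {l} {r} _ _ _) leaf eq with () ← length-word-injective (node s l r) leaf eq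
word-injective o (node {s} {l} {r} cl cr nr) (node {s′} {l′} {r′} cl′ cr′ nr′) eq
  with refl ← split-sign (word (leftOffset s o r) l) (word (leftOffset s′ o r′) l′) eq
                (word-nonEmpty _ l) (word-nonEmpty _ l′) (word-nonEmpty _ r) (word-nonEmpty _ r′)
                (word-≺ s o l r) (word-≺ s′ o l′ r′)
  with p , q ← canonical-blocks s o l l′ r r′ nr nr′ eq
  = cong₂ (node s)
      (word-injective _ cl cl′ (trans p (cong (λ k → word k l′)
        (leftOffset-cong s o r′ r (sym (length-word-injective r r′ q))))))
      (word-injective _ cr cr′ (trans q (cong (λ k → word k r′)
        (rightOffset-cong s o l′ l (sym (length-word-injective l l′ p))))))

-- The canonical form of `node s l r`: rotations carry l down the left spine of r as long as the
-- labels there equal s.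
join : Sign → Tree → Tree → Tree
join s l leaf = node s l leaf
join s l (node s′ r₁ r₂) with s Sign.≟ s′
... | yes _ = node s (join s l r₁) r₂
... | no  _ = node s l (node s′ r₁ r₂)

join-canonical : ∀ s {l r} → Canonical l → Canonical r → Canonical (join s l r)
join-canonical s cl leaf = node cl leaf tt
join-canonical s cl (node {s′} c₁ c₂ nr) with s Sign.≟ s′
... | yes refl = node (join-canonical s cl c₁) c₂ nr
... | no s≢s′  = node cl (node c₁ c₂ nr) (≢⇒opposite s s′ s≢s′)
  where
  ≢⇒opposite : ∀ s s′ → s ≢ s′ → s′ ≡ opposite s
  ≢⇒opposite asc asc s≢s = contradiction refl s≢s
  ≢⇒opposite asc dsc _   = refl
  ≢⇒opposite dsc asc _   = refl
  ≢⇒opposite dsc dsc s≢s = contradiction refl s≢s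

nodes-join : ∀ s l r → nodes (join s l r) ≡ suc (nodes l ℕ.+ nodes r)
nodes-join s l leaf = refl
nodes-join s l (node s′ r₁ r₂) with s Sign.≟ s′
... | no  _ = refl
... | yes _ = cong suc (begin
  nodes (join s l r₁) ℕ.+ nodes r₂          ≡⟨ cong (ℕ._+ nodes r₂) (nodes-join s l r₁) ⟩
  suc (nodes l ℕ.+ nodes r₁ ℕ.+ nodes r₂)   ≡⟨ cong suc (ℕ.+-assoc (nodes l) (nodes r₁) (nodes r₂)) ⟩
  suc (nodes l ℕ.+ (nodes r₁ ℕ.+ nodes r₂)) ≡⟨ ℕ.+-suc (nodes l) _ ⟨
  nodes l ℕ.+ suc (nodes r₁ ℕ.+ nodes r₂)   ∎)

-- A rotation between equal labels only rebrackets the concatenation of three blocks, and their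
-- offsets agree because leaf counts add.
word-join : ∀ s o l r → word o (join s l r) ≡ word o (node s l r)
word-join s o l leaf = refl
word-join s o l (node s′ r₁ r₂) with s Sign.≟ s′
word-join s o l (node s′ r₁ r₂) | no  _ = refl
word-join asc o l (node _ r₁ r₂) | yes refl = begin
  word o (join asc l r₁) ++ word (o ℕ.+ leaves (join asc l r₁)) r₂
    ≡⟨ cong₂ (λ w k → w ++ word k r₂) (word-join asc o l r₁)
         (trans (cong (λ k → o ℕ.+ suc k) (nodes-join asc l r₁)) (sym (leaves-node o l r₁))) ⟩
  (word o l ++ word (o ℕ.+ leaves l) r₁) ++ word (o ℕ.+ leaves l ℕ.+ leaves r₁) r₂
    ≡⟨ List.++-assoc (word o l) _ _ ⟩
  word o l ++ (word (o ℕ.+ leaves l) r₁ ++ word (o ℕ.+ leaves l ℕ.+ leaves r₁) r₂) ∎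
word-join dsc o l (node _ r₁ r₂) | yes refl = begin
  word (o ℕ.+ leaves r₂) (join dsc l r₁) ++ word o r₂
    ≡⟨ cong (_++ word o r₂) (word-join dsc (o ℕ.+ leaves r₂) l r₁) ⟩
  (word (o ℕ.+ leaves r₂ ℕ.+ leaves r₁) l ++ word (o ℕ.+ leaves r₂) r₁) ++ word o r₂
    ≡⟨ List.++-assoc (word (o ℕ.+ leaves r₂ ℕ.+ leaves r₁) l) _ _ ⟩
  word (o ℕ.+ leaves r₂ ℕ.+ leaves r₁) l ++ (word (o ℕ.+ leaves r₂) r₁ ++ word o r₂)
    ≡⟨ cong (λ k → word k l ++ (word (o ℕ.+ leaves r₂) r₁ ++ word o r₂))
         (trans (leaves-node o r₂ r₁) (cong (λ k → o ℕ.+ suc (suc k)) (ℕ.+-comm (nodes r₂) (nodes r₁)))) ⟩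
  word (o ℕ.+ leaves (node dsc r₁ r₂)) l ++ (word (o ℕ.+ leaves r₂) r₁ ++ word o r₂) ∎

IsWordOf : ℕ → List ℕ → Tree → Set
IsWordOf o w t = Canonical t × word o t ≡ w

join-word : ∀ s o {u v t t′} → IsWordOf (leftOffset s o t′) u t → IsWordOf (rightOffset s o t) v t′ →
            IsWordOf o (u ++ v) (join s t t′)
join-word s o {t = t} {t′} (c , eq) (c′ , eq′) =
  join-canonical s c c′ , trans (word-join s o t t′) (cong₂ _++_ eq eq′)

-- The bound k on the length makes the recursion structural: the blocks are decomposed afresh, so
-- their decompositions are not subterms of the given one.
treeOf : ∀ k o {w} → Decomposition w → length w ≤ k → Unique w → Avoiding w →
         Within o (o ℕ.+ length w) w → ∃ (IsWordOf o w)
treeOf (suc k) o (single x) le w! av within = leaf , leaf , cong [_]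
  (ℕ.≤-antisym (proj₁ (within (here refl)))
    (ℕ.≤-pred (subst (x <_) (ℕ.+-comm o 1) (proj₂ (within (here refl))))))
treeOf (suc k) o (split s a u b v u≺v) (s≤s le) w! av within = build s u≺v
  where
  |w| : length ((a ∷ u) ++ (b ∷ v)) ≡ length (a ∷ u) ℕ.+ length (b ∷ v)
  |w| = List.length-++ (a ∷ u)

  |u|≤k : length (a ∷ u) ≤ k
  |u|≤k = ℕ.≤-trans (subst (length (a ∷ u) ≤_)
            (trans (cong suc (ℕ.+-comm (length u) (length v)))
                   (trans (ℕ.+-comm (suc (length v)) (length u)) (sym (List.length-++ u))))
            (s≤s (ℕ.m≤m+n (length u) (length v)))) le

  |v|≤k : length (b ∷ v) ≤ k
  |v|≤k = ℕ.≤-trans (subst (length (b ∷ v) ≤_) (sym (List.length-++ u)) (ℕ.m≤n+m _ (length u))) le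

  u! = Unique-⊆ (⊆-++ˡ (a ∷ u) (b ∷ v)) w!
  v! = Unique-⊆ (⊆-++ʳ (a ∷ u) (b ∷ v)) w!

  recurseᵘ : ∀ o → Within o (o ℕ.+ length (a ∷ u)) (a ∷ u) → ∃ (IsWordOf o (a ∷ u))
  recurseᵘ o = let avu = Avoiding-⊆ (⊆-++ˡ (a ∷ u) (b ∷ v)) av in
    treeOf k o (decompose a u u! avu) |u|≤k u! avu

  recurseᵛ : ∀ o → Within o (o ℕ.+ length (b ∷ v)) (b ∷ v) → ∃ (IsWordOf o (b ∷ v))
  recurseᵛ o = let avv = Avoiding-⊆ (⊆-++ʳ (a ∷ u) (b ∷ v)) av in
    treeOf k o (decompose b v v! avv) |v|≤k v! avv

  within′ : Within o (o ℕ.+ (length (a ∷ u) ℕ.+ length (b ∷ v))) ((a ∷ u) ++ (b ∷ v))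
  within′ = subst (λ n → Within o (o ℕ.+ n) ((a ∷ u) ++ (b ∷ v))) |w| within

  -- For dsc the block v takes the lower values, so the two lengths change places before
  -- `blocks-within` is applied.
  withinˢ : Within o (o ℕ.+ (length (b ∷ v) ℕ.+ length (a ∷ u))) ((a ∷ u) ++ (b ∷ v))
  withinˢ = subst (λ n → Within o (o ℕ.+ n) ((a ∷ u) ++ (b ∷ v))) (ℕ.+-comm (length (a ∷ u)) _) within′

  leaves-length : ∀ o {w t} → IsWordOf o w t → length w ≡ leaves t
  leaves-length o {t = t} (_ , eq) = trans (cong length (sym eq)) (length-word o t)

  build : ∀ s → (a ∷ u) ≺[ s ] (b ∷ v) → ∃ (IsWordOf o ((a ∷ u) ++ (b ∷ v)))
  build asc u≺v =
    let wu , wv  = blocks-within o u≺v u! v! (within′ ∘ ∈-++⁺ˡ) (within′ ∘ ∈-++⁺ʳ (a ∷ u))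
        t  , ist = recurseᵘ o wu
        t′ , is′ = recurseᵛ (o ℕ.+ length (a ∷ u)) wv
    in join asc t t′ , join-word asc o {t = t} {t′ = t′} ist
         (subst (λ n → IsWordOf (o ℕ.+ n) (b ∷ v) t′) (leaves-length o {t = t} ist) is′)
  build dsc u≺v =
    let wv , wu  = blocks-within o (λ p q → u≺v q p) v! u! (withinˢ ∘ ∈-++⁺ʳ (a ∷ u)) (withinˢ ∘ ∈-++⁺ˡ)
        t′ , is′ = recurseᵛ o wv
        t  , ist = recurseᵘ (o ℕ.+ length (b ∷ v)) wu
    in join dsc t t′ , join-word dsc o {t = t} {t′ = t′}
         (subst (λ n → IsWordOf (o ℕ.+ n) (a ∷ u) t) (leaves-length o {t = t′} is′) ist) is′

-- Descent words

sign : ℕ → ℕ → Sign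
sign x y = if does (y ℕ.<? x) then dsc else asc

signs : List ℕ → List Sign
signs []          = []
signs (x ∷ [])    = []
signs (x ∷ y ∷ w) = sign x y ∷ signs (y ∷ w)

sign-≡ : ∀ s {x y} → x <[ s ] y → sign x y ≡ s
sign-≡ asc {x} {y} p = cong (λ z → if z then dsc else asc) (dec-false (y ℕ.<? x) (ℕ.<-asym p))
sign-≡ dsc {x} {y} p = cong (λ z → if z then dsc else asc) (dec-true (y ℕ.<? x) p)

signs-++ : ∀ s a u b v → (a ∷ u) ≺[ s ] (b ∷ v) →
           signs ((a ∷ u) ++ (b ∷ v)) ≡ signs (a ∷ u) ++ s ∷ signs (b ∷ v)
signs-++ s a []       b v p = cong (_∷ signs (b ∷ v)) (sign-≡ s (p (here refl) (here refl)))
signs-++ s a (a′ ∷ u) b v p = cong (sign a a′ ∷_) (signs-++ s a′ u b v (p ∘ there))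

-- The two letters meeting at the border of a node's blocks compare according to its label; all
-- other neighbours lie within a block.
signs-word : ∀ o t → signs (word o t) ≡ inorder t
signs-word o leaf         = refl
signs-word o (node s l r)
  -- The words are abstracted together with every fact about them that is used, so that matching on
  -- `word-head` exposes the heads required by `signs-++`.
  with word (leftOffset s o r) l | word-head (leftOffset s o r) l | signs-word (leftOffset s o r) l
     | word (rightOffset s o l) r | word-head (rightOffset s o l) r | signs-word (rightOffset s o l) r
     | word-≺ s o l r
... | _ | a , u , refl | eqˡ | _ | b , v , refl | eqʳ | p =
  trans (signs-++ s a u b v p) (cong₂ (λ x y → x ++ s ∷ y) eqˡ eqʳ)

-- Permutations as lists of numbers

letters : Word m n → List ℕ
letters []      = []
letters (x ∷ π) = toℕ x ∷ letters π

length-letters : (π : Word m n) → length (letters π) ≡ n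
length-letters []      = refl
length-letters (x ∷ π) = cong suc (length-letters π)

letters-injective : {π ρ : Word m n} → letters π ≡ letters ρ → π ≡ ρ
letters-injective {π = []}    {[]}    eq = refl
letters-injective {π = x ∷ π} {y ∷ ρ} eq =
  let p , q = List.∷-injective eq in cong₂ _∷_ (Fin.toℕ-injective p) (letters-injective q)

letters-within : (π : Word m n) → Within 0 m (letters π)
letters-within (x ∷ π) (here refl) = z≤n , Fin.toℕ<n x
letters-within (x ∷ π) (there a∈)  = letters-within π a∈

fromLetters : ∀ w → Within 0 m w → length w ≡ n → ∃ λ (π : Word m n) → letters π ≡ w
fromLetters []      within refl = [] , refl
fromLetters (x ∷ w) within refl =
  let x<m    = proj₂ (within (here refl))
      π , eq = fromLetters w (within ∘ there) refl
  in Fin.fromℕ< x<m ∷ π , cong₂ _∷_ (Fin.toℕ-fromℕ< x<m) eq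

∈-letters⁺ : (π : Word m n) (i : Fin n) → toℕ (lookup π i) ∈ letters π
∈-letters⁺ (x ∷ π) zero    = here refl
∈-letters⁺ (x ∷ π) (suc i) = there (∈-letters⁺ π i)

∈-letters⁻ : (π : Word m n) {a : ℕ} → a ∈ letters π → ∃ λ i → a ≡ toℕ (lookup π i)
∈-letters⁻ (x ∷ π) (here refl) = zero , refl
∈-letters⁻ (x ∷ π) (there a∈)  = let i , eq = ∈-letters⁻ π a∈ in suc i , eq

letters-unique⁺ : (π : Word m n) → Injective _≡_ _≡_ (lookup π) → Unique (letters π)
letters-unique⁺ []      inj = ListAllPairs.[]
letters-unique⁺ (x ∷ π) inj =
  ListAll.tabulate (λ a∈ x≡a → let i , eq = ∈-letters⁻ π a∈ in
    case inj {zero} {suc i} (Fin.toℕ-injective (trans x≡a eq)) of λ ())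
  ListAllPairs.∷ letters-unique⁺ π (Fin.suc-injective ∘ inj)

letters-unique⁻ : (π : Word m n) → Unique (letters π) → Injective _≡_ _≡_ (lookup π)
letters-unique⁻ (x ∷ π) π! {zero} {zero} eq = refl
letters-unique⁻ (x ∷ π) π! {zero} {suc j} refl = contradiction (∈-letters⁺ π j) (Unique.Unique[x∷xs]⇒x∉xs π!)
letters-unique⁻ (x ∷ π) π! {suc i} {zero} refl = contradiction (∈-letters⁺ π i) (Unique.Unique[x∷xs]⇒x∉xs π!)
letters-unique⁻ (x ∷ π) (_ ListAllPairs.∷ π!) {suc i} {suc j} eq = cong suc (letters-unique⁻ π π! eq)

-- A missed value could be punched out of the codomain, leaving an injection of `Fin (suc n)` into
-- `Fin n`.
injective⇒surjective : {f : Fin n → Fin n} → Injective _≡_ _≡_ f → Surjective _≡_ _≡_ f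
injective⇒surjective {suc n} {f} inj y with Fin.any? (λ x → f x Fin.≟ y)
... | yes (x , eq) = x , λ { refl → eq }
... | no ∄x = contradiction
  (Fin.injective⇒≤ {f = λ x → Fin.punchOut (y≢f x)}
    (λ {x} {x′} eq → inj (Fin.punchOut-injective (y≢f x) (y≢f x′) eq)))
  ℕ.1+n≰n
  where
  y≢f : ∀ x → y ≢ f x
  y≢f x y≡fx = ∄x (x , sym y≡fx)

-- Pattern avoidance

letters-map-suc : ∀ (x : Fin m) (π : Word m n) (p : Word n k) →
  letters (Vec.map (lookup (x ∷ π)) (Vec.map suc p)) ≡ letters (Vec.map (lookup π) p)
letters-map-suc x π []      = refl
letters-map-suc x π (i ∷ p) = cong (toℕ (lookup π i) ∷_) (letters-map-suc x π p)

⊆⇒positions : (π : Word m n) {w : List ℕ} → w ⊆ letters π →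
  ∃ λ (p : Word n (length w)) → AllPairs Fin._<_ p × letters (Vec.map (lookup π) p) ≡ w
⊆⇒positions [] [] = [] , [] , refl
⊆⇒positions (x ∷ π) (_ ∷ʳ τ) =
  let p , inc , eq = ⊆⇒positions π τ
  in Vec.map suc p , AllPairs.map⁺ (AllPairs.map s≤s inc) , trans (letters-map-suc x π p) eq
⊆⇒positions (x ∷ π) (refl ∷ τ) =
  let p , inc , eq = ⊆⇒positions π τ
  in zero ∷ Vec.map suc p
     , All.map⁺ (All.universal (λ _ → s≤s z≤n) p) ∷ AllPairs.map⁺ (AllPairs.map s≤s inc)
     , cong (toℕ x ∷_) (trans (letters-map-suc x π p) eq)

positive⇒map-suc : (p : Word (suc n) k) → All (Fin._<_ {suc n} zero) p → ∃ λ q → p ≡ Vec.map suc q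
positive⇒map-suc []          []         = [] , refl
positive⇒map-suc (suc i ∷ p) (_ ∷ 0<p) = let q , eq = positive⇒map-suc p 0<p in i ∷ q , cong (suc i ∷_) eq

increasing-map-suc⁻ : (p : Word n k) → AllPairs Fin._<_ (Vec.map Fin.suc p) → AllPairs Fin._<_ p
increasing-map-suc⁻ []      []        = []
increasing-map-suc⁻ (i ∷ p) (i< ∷ inc) = All.map ℕ.s≤s⁻¹ (All.map⁻ i<) ∷ increasing-map-suc⁻ p inc

positions⇒⊆ : (π : Word m n) (p : Word n k) → AllPairs Fin._<_ p →
              letters (Vec.map (lookup π) p) ⊆ letters π
-- When no position is zero, x is skipped and all positions drop by one; this is the common
-- continuation of both nonempty cases.
positions⇒⊆-positive : ∀ (x : Fin m) (π : Word m n) (p : Word (suc n) k) →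
  All (Fin._<_ {suc n} zero) p → AllPairs Fin._<_ p → letters (Vec.map (lookup (x ∷ π)) p) ⊆ letters π

positions⇒⊆ []      []          inc        = []
positions⇒⊆ (x ∷ π) []          inc        = Sub.minimum _
positions⇒⊆ (x ∷ π) (zero ∷ p)  (0< ∷ inc) = refl ∷ positions⇒⊆-positive x π p 0< inc
positions⇒⊆ (x ∷ π) (suc i ∷ p) (i< ∷ inc) = toℕ x ∷ʳ positions⇒⊆-positive x π (suc i ∷ p)
  (s≤s z≤n ∷ All.map (ℕ.≤-trans (s≤s z≤n)) i<) (i< ∷ inc)

positions⇒⊆-positive x π p 0<p inc with q , refl ← positive⇒map-suc p 0<p =
  subst (_⊆ letters π) (sym (letters-map-suc x π q)) (positions⇒⊆ π q (increasing-map-suc⁻ q inc))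

-- By trichotomy, a monotone map out of a pattern with distinct entries also reflects the order, so
-- only one direction has to be checked.
occurrence : (σ : Pattern k) → Injective _≡_ _≡_ (lookup σ) → (f : Fin k → ℕ) →
  (∀ i j → lookup σ i < lookup σ j → f i < f j) → ∀ i j → lookup σ i < lookup σ j ⇔ f i < f j
occurrence σ inj f mono i j = mk⇔ (mono i j) reflect
  where
  reflect : f i < f j → lookup σ i < lookup σ j
  reflect fi<fj with ℕ.<-cmp (lookup σ i) (lookup σ j)
  ... | tri< p _ _ = p
  ... | tri≈ _ p _ = contradiction fi<fj (ℕ.<-irrefl (cong f (inj p)))
  ... | tri> _ _ p = contradiction fi<fj (ℕ.<-asym (mono j i p))

p2413-injective : Injective _≡_ _≡_ (lookup p2413)
p2413-injective {i} {j} = toWitness {a? = Fin.all? λ i → Fin.all? λ j →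
  (lookup p2413 i ℕ.≟ lookup p2413 j) →-dec (i Fin.≟ j)} _ i j

p3142-injective : Injective _≡_ _≡_ (lookup p3142)
p3142-injective {i} {j} = toWitness {a? = Fin.all? λ i → Fin.all? λ j →
  (lookup p3142 i ℕ.≟ lookup p3142 j) →-dec (i Fin.≟ j)} _ i j

-- The positions of a forbidden sublist form an occurrence. Transitivity along its chain of three
-- inequalities gives the six true comparisons; the other index pairs are refuted numerically.
avoids⇒avoiding : (π : Word m n) → Avoids p2413 π → Avoids p3142 π → Avoiding (letters π)
avoids⇒avoiding π av₂ av₃ s τ with ⊆⇒positions π τ
avoids⇒avoiding π av₂ av₃ asc τ | p@(_ ∷ _ ∷ _ ∷ _ ∷ []) , inc , refl = λ b<d d<a a<c →
  av₃ (p , inc , occurrence p3142 p3142-injective (toℕ ∘ lookup π ∘ lookup p) λ where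
    0F 0F (s≤s (s≤s (s≤s ())))
    0F 1F (s≤s ())
    0F 2F _ → a<c
    0F 3F (s≤s (s≤s ()))
    1F 0F _ → ℕ.<-trans b<d d<a
    1F 1F (s≤s ())
    1F 2F _ → ℕ.<-trans b<d (ℕ.<-trans d<a a<c)
    1F 3F _ → b<d
    2F 0F (s≤s (s≤s (s≤s ())))
    2F 1F (s≤s ())
    2F 2F (s≤s (s≤s (s≤s (s≤s ()))))
    2F 3F (s≤s (s≤s ()))
    3F 0F _ → d<a
    3F 1F (s≤s ())
    3F 2F _ → ℕ.<-trans d<a a<c
    3F 3F (s≤s (s≤s ())))
avoids⇒avoiding π av₂ av₃ dsc τ | p@(_ ∷ _ ∷ _ ∷ _ ∷ []) , inc , refl = λ d<b a<d c<a →
  av₂ (p , inc , occurrence p2413 p2413-injective (toℕ ∘ lookup π ∘ lookup p) λ where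
    0F 0F (s≤s (s≤s ()))
    0F 1F _ → ℕ.<-trans a<d d<b
    0F 2F (s≤s ())
    0F 3F _ → a<d
    1F 0F (s≤s (s≤s ()))
    1F 1F (s≤s (s≤s (s≤s (s≤s ()))))
    1F 2F (s≤s ())
    1F 3F (s≤s (s≤s (s≤s ())))
    2F 0F _ → c<a
    2F 1F _ → ℕ.<-trans c<a (ℕ.<-trans a<d d<b)
    2F 2F (s≤s ())
    2F 3F _ → ℕ.<-trans c<a a<d
    3F 0F (s≤s (s≤s ()))
    3F 1F _ → d<b
    3F 2F (s≤s ())
    3F 3F (s≤s (s≤s (s≤s ()))))

avoiding⇒avoids-3142 : (π : Word m n) → Avoiding (letters π) → Avoids p3142 π
avoiding⇒avoids-3142 π av (p@(_ ∷ _ ∷ _ ∷ _ ∷ []) , inc , occ) = av asc (positions⇒⊆ π p inc)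
  -- The chain 1 < 2 < 3 < 4 of pattern values suffices; `1 < 2` unfolds to `2 ≤ 2`, and so on.
  (Equivalence.to (occ 1F 3F) (ℕ.≤ᵇ⇒≤ 2 2 _))
  (Equivalence.to (occ 3F 0F) (ℕ.≤ᵇ⇒≤ 3 3 _))
  (Equivalence.to (occ 0F 2F) (ℕ.≤ᵇ⇒≤ 4 4 _))

avoiding⇒avoids-2413 : (π : Word m n) → Avoiding (letters π) → Avoids p2413 π
avoiding⇒avoids-2413 π av (p@(_ ∷ _ ∷ _ ∷ _ ∷ []) , inc , occ) = av dsc (positions⇒⊆ π p inc)
  (Equivalence.to (occ 3F 1F) (ℕ.≤ᵇ⇒≤ 4 4 _))
  (Equivalence.to (occ 0F 3F) (ℕ.≤ᵇ⇒≤ 3 3 _))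
  (Equivalence.to (occ 2F 0F) (ℕ.≤ᵇ⇒≤ 2 2 _))

separable⇔ : (π : Word n n) → IsSeparable π ⇔ (Unique (letters π) × Avoiding (letters π))
separable⇔ π = mk⇔
  (λ ((inj , _) , av₂ , av₃) → letters-unique⁺ π inj , avoids⇒avoiding π av₂ av₃)
  (λ (π! , av) → let inj = letters-unique⁻ π π! in
    (inj , injective⇒surjective inj) , avoiding⇒avoids-2413 π av , avoiding⇒avoids-3142 π av)

map-unique : ∀ (f : A → B) {xs} → (∀ {x y} → x ∈ xs → y ∈ xs → f x ≡ f y → x ≡ y) → Unique xs → Unique (List.map f xs)
map-unique f inj ListAllPairs.[] = ListAllPairs.[]
map-unique f {x ∷ xs} inj (x∉ ListAllPairs.∷ xs!) =
  ListAll.map⁺ (ListAll.tabulate λ y∈ fx≡fy → ListAll.lookup x∉ y∈ (inj (here refl) (there y∈) fx≡fy))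
  ListAllPairs.∷ map-unique f (λ p q → inj (there p) (there q)) xs!

separable-tree : (π : Word (suc n) (suc n)) → IsSeparable π → ∃ λ t → t ∈ trees n n × word 0 t ≡ letters π
separable-tree {n} π@(x ∷ ρ) sep =
  let π! , av    = Equivalence.to (separable⇔ π) sep
      |π|        = length-letters π
      t , c , eq = treeOf (suc n) 0 (decompose (toℕ x) (letters ρ) π! av) (ℕ.≤-reflexive |π|) π! av
                     (subst (λ k → Within 0 k (letters π)) (sym |π|) (letters-within π))
      |t|        = ℕ.suc-injective (trans (sym (length-word 0 t)) (trans (cong length eq) |π|))
  in t , subst (λ k → t ∈ trees n k) |t| (∈-trees⁺ n (ℕ.≤-reflexive |t|) c) , eq

tree-separable : ∀ {t} → t ∈ trees n n → ∃ λ (π : Word (suc n) (suc n)) → IsSeparable π × letters π ≡ word 0 t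
tree-separable {n} {t} t∈ with refl , _ ← ∈-trees⁻ n n t∈ =
  let π , eq = fromLetters (word 0 t) (word-within 0 t) (length-word 0 t)
  in π , Equivalence.from (separable⇔ π)
           (subst Unique (sym eq) (word-unique 0 t) , subst Avoiding (sym eq) (word-avoiding 0 t)) , eq

-- Mapped to lists of numbers, permutations and canonical trees give duplicate-free lists with the
-- same members. The arbitrary f covers both the signed sum and the count of alternating
-- permutations.
∑-separable : ∀ n (f : List Sign → ℤ) →
  ∑ (𝔖 (suc n)) (f ∘ signs ∘ letters) ≡ ∑ (trees n n) (f ∘ inorder)
∑-separable n f = begin
  ∑ (𝔖 (suc n)) (f ∘ signs ∘ letters)
    ≡⟨ ∑-map letters (𝔖 (suc n)) (f ∘ signs) ⟨
  ∑ (List.map letters (𝔖 (suc n))) (f ∘ signs)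
    ≡⟨ ∑-set (f ∘ signs) (Unique.map⁺ letters-injective (𝔖-unique (suc n)))
         (map-unique (word 0) (λ p q → word-injective 0 (proj₂ (∈-trees⁻ n n p)) (proj₂ (∈-trees⁻ n n q)))
           (trees-unique n n))
         (mk⇔ to from) ⟩
  ∑ (List.map (word 0) (trees n n)) (f ∘ signs)
    ≡⟨ ∑-map (word 0) (trees n n) (f ∘ signs) ⟩
  ∑ (trees n n) (f ∘ signs ∘ word 0)
    ≡⟨ ∑-cong (trees n n) (f ∘ signs ∘ word 0) (f ∘ inorder) (λ {t} _ → cong f (signs-word 0 t)) ⟩
  ∑ (trees n n) (f ∘ inorder) ∎
  where
  to : ∀ {w} → w ∈ List.map letters (𝔖 (suc n)) → w ∈ List.map (word 0) (trees n n)
  to w∈ =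
    let π , π∈ , w≡   = ∈-map⁻ letters w∈
        t , t∈ , t≡   = separable-tree π (Equivalence.to (∈-𝔖 π) π∈)
    in subst (_∈ List.map (word 0) (trees n n)) (trans t≡ (sym w≡)) (∈-map⁺ (word 0) t∈)

  from : ∀ {w} → w ∈ List.map (word 0) (trees n n) → w ∈ List.map letters (𝔖 (suc n))
  from w∈ =
    let t , t∈ , w≡   = ∈-map⁻ (word 0) w∈
        π , sep , π≡  = tree-separable {n} t∈
    in subst (_∈ List.map letters (𝔖 (suc n))) (trans π≡ (sym w≡)) (∈-map⁺ letters (Equivalence.from (∈-𝔖 π) sep))

-- Descents and alternation

count-tabulate : ∀ {P : B → Set} (P? : Decidable P) (g : A → B) (f : Fin n → A) →
  count P? (tabulate (g ∘ f)) ≡ count (P? ∘ g) (tabulate f)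
count-tabulate {n = zero}  P? g f = refl
count-tabulate {n = suc n} P? g f with does (P? (g (f zero)))
... | true  = cong suc (count-tabulate P? g (f ∘ suc))
... | false = count-tabulate P? g (f ∘ suc)

-- `count` and `sign` branch on the same Boolean, which settles the first pair; the remaining pairs
-- are those of the tail, reindexed by `count-tabulate`.
des-signs : (π : Word m n) → -1ℤ ^ des π ≡ sgn (signs (letters π))
des-signs []          = refl
des-signs (x ∷ [])    = refl
des-signs (x ∷ y ∷ π) = begin
  -1ℤ ^ des (x ∷ y ∷ π)
    ≡⟨ first (does (toℕ y ℕ.<? toℕ x)) _ ⟩
  weight (sign (toℕ x) (toℕ y)) * -1ℤ ^ count descent? (tabulate suc)
    ≡⟨ cong (λ d → weight (sign (toℕ x) (toℕ y)) * -1ℤ ^ d) (count-tabulate descent? suc id) ⟩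
  weight (sign (toℕ x) (toℕ y)) * -1ℤ ^ des (y ∷ π)
    ≡⟨ cong (weight (sign (toℕ x) (toℕ y)) *_) (des-signs (y ∷ π)) ⟩
  weight (sign (toℕ x) (toℕ y)) * sgn (signs (toℕ y ∷ letters π)) ∎
  where
  descent? : ∀ i → Dec (lookup (x ∷ y ∷ π) (suc i) Fin.< lookup (x ∷ y ∷ π) (inject₁ i))
  descent? i = lookup (x ∷ y ∷ π) (suc i) Fin.<? lookup (x ∷ y ∷ π) (inject₁ i)

  first : ∀ b d → -1ℤ ^ (if b then suc else id) d ≡ weight (if b then dsc else asc) * -1ℤ ^ d
  first true  d = refl
  first false d = sym (ℤ.*-identityˡ _)

double≡2* : ∀ n → double n ≡ 2 ℕ.* n
double≡2* zero    = refl
double≡2* (suc n) = cong suc (trans (cong suc (double≡2* n)) (sym (ℕ.+-suc n (n ℕ.+ 0))))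

2∣double : ∀ h → 2 ∣ double h
2∣double h = divides h (trans (double≡2* h) (ℕ.*-comm 2 h))

2∤1+double : ∀ h → 2 ∤ suc (double h)
2∤1+double zero    = toWitnessFalse {a? = 2 ∣? 1} _
2∤1+double (suc h) = 2∤1+double h ∘ λ 2∣ → ∣m+n∣m⇒∣n {m = 2} 2∣ ∣-refl

-- Alternation with either initial direction, without divisibility, so that the tail of an
-- alternating word is covered by the opposite sign.
Alternates : Sign → Word m (suc n) → Set
Alternates c π = ∀ i → toℕ (lookup π (inject₁ i)) <[ flips (toℕ i) c ] toℕ (lookup π (suc i))

-- Index i stands for the 1-based position `suc i`, so an ascent is expected at even i.
flips-parity : ∀ i → (2 ∤ suc i × flips i asc ≡ asc) ⊎ (2 ∣ suc i × flips i asc ≡ dsc)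
flips-parity zero          = inj₁ (2∤1+double 0 , refl)
flips-parity (suc zero)    = inj₂ (∣-refl , refl)
flips-parity (suc (suc i)) with flips-parity i
... | inj₁ (2∤ , eq) = inj₁ ((λ 2∣ → 2∤ (∣m+n∣m⇒∣n {m = 2} 2∣ ∣-refl)) , eq)
... | inj₂ (2∣ , eq) = inj₂ (∣m∣n⇒∣m+n {m = 2} ∣-refl 2∣ , eq)

alternating⇔ : (π : Word m (suc n)) → IsAlternating π ⇔ Alternates asc π
alternating⇔ {n = n} π = mk⇔ to from
  where
  to : IsAlternating π → Alternates asc π
  to alt i with flips-parity (toℕ i)
  ... | inj₁ (2∤ , eq) rewrite eq = proj₁ (alt i) 2∤
  ... | inj₂ (2∣ , eq) rewrite eq = proj₂ (alt i) 2∣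

  from : Alternates asc π → IsAlternating π
  from alt i with flips-parity (toℕ i) | alt i
  ... | inj₁ (2∤ , eq) | lt rewrite eq = (λ _ → lt) , λ 2∣ → contradiction 2∣ 2∤
  ... | inj₂ (2∣ , eq) | lt rewrite eq = contradiction 2∣ , λ _ → lt

δ-same : ∀ c → δ c c ≡ 1ℤ
δ-same asc = refl
δ-same dsc = refl

δ-opposite : ∀ c → δ c (opposite c) ≡ 0ℤ
δ-opposite asc = refl
δ-opposite dsc = refl

-- Uniqueness excludes equal neighbours, which `sign` would read as an ascent.
altFrom-signs : ∀ c (π : Word m (suc n)) → Unique (letters π) →
  (Alternates c π × altFrom c (signs (letters π)) ≡ 1ℤ) ⊎ (¬ Alternates c π × altFrom c (signs (letters π)) ≡ 0ℤ)
altFrom-signs c (x ∷ [])    π! = inj₁ ((λ ()) , refl)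
altFrom-signs c (x ∷ y ∷ π) π!@(_ ListAllPairs.∷ ρ!)
  with <[]-connex c (λ x≡y → Unique.Unique[x∷xs]⇒x∉xs π! (here x≡y)) | altFrom-signs (opposite c) (y ∷ π) ρ!
... | inj₂ y<x | _ = inj₂ ((λ alt → <[]-asym c y<x (alt zero)) ,
  cong (_* altFrom (opposite c) (signs (toℕ y ∷ letters π)))
    (trans (cong (δ c) (sign-≡ (opposite c) (<[]-opposite c y<x))) (δ-opposite c)))
... | inj₁ x<y | rest
  rewrite sign-≡ c x<y | δ-same c | ℤ.*-identityˡ (altFrom (opposite c) (signs (toℕ y ∷ letters π))) with rest
...   | inj₁ (alt , eq)  = inj₁ ((λ { zero → x<y ; (suc i) → alt i }) , eq)
...   | inj₂ (¬alt , eq) = inj₂ ((λ alt → ¬alt (alt ∘ suc)) , eq)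

∑-filter : ∀ {P : A → Set} (P? : Decidable P) xs (f : A → ℤ) →
  (∀ {x} → x ∈ xs → (P x × f x ≡ 1ℤ) ⊎ (¬ P x × f x ≡ 0ℤ)) → ∑ xs f ≡ + length (filter P? xs)
∑-filter P? []       f ind = refl
∑-filter P? (x ∷ xs) f ind with ind (here refl)
... | inj₁ (px , eq) rewrite List.filter-accept P? {x} {xs} px | eq | ∑-filter P? xs f (ind ∘ there) = refl
... | inj₂ (¬px , eq) rewrite List.filter-reject P? {x} {xs} ¬px | eq | ∑-filter P? xs f (ind ∘ there) = refl

alternating-indicator : (π : Word m (suc n)) → Unique (letters π) →
  (IsAlternating π × altFrom asc (signs (letters π)) ≡ 1ℤ) ⊎
  (¬ IsAlternating π × altFrom asc (signs (letters π)) ≡ 0ℤ)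
alternating-indicator π π! = Sum.map
  (λ (alt , eq) → Equivalence.from (alternating⇔ π) alt , eq)
  (λ (¬alt , eq) → ¬alt ∘ Equivalence.to (alternating⇔ π) , eq)
  (altFrom-signs asc π π!)

∑-alternating : ∀ n → ∑ (𝔖 (suc n)) (altFrom asc ∘ signs ∘ letters) ≡ + length (𝔄 (suc n))
∑-alternating n = ∑-filter isAlternating? (𝔖 (suc n)) (altFrom asc ∘ signs ∘ letters)
  λ {π} π∈ → alternating-indicator π (proj₁ (Equivalence.to (separable⇔ π) (Equivalence.to (∈-𝔖 π) π∈)))

signed-sum : ∀ n → ∑ (𝔖 (suc n)) (λ π → -1ℤ ^ des π) ≡ dilate (evens (altCount asc)) n
signed-sum n = begin
  ∑ (𝔖 (suc n)) (λ π → -1ℤ ^ des π)        ≡⟨ ∑-cong (𝔖 (suc n)) _ _ (λ {π} _ → des-signs π) ⟩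
  ∑ (𝔖 (suc n)) (sgn ∘ signs ∘ letters)    ≡⟨ ∑-separable n sgn ⟩
  signedCount n                            ≡⟨ signedCount≗dilate n ⟩
  dilate (evens (altCount asc)) n          ∎

-- A tree with 2n nodes has 2n + 1 leaves, so degree 2n counts alternating permutations of length 2n
-- + 1.
evens-altCount : ∀ n → evens (altCount asc) n ≡ + r n
evens-altCount n = trans (sym (∑-separable (double n) (altFrom asc)))
  (trans (∑-alternating (double n)) (cong (λ k → + length (𝔄 (suc k))) (double≡2* n)))

parity : ∀ n → (∃ λ h → n ≡ double h) ⊎ (∃ λ h → n ≡ suc (double h))
parity zero    = inj₁ (0 , refl)
parity (suc n) with parity n
... | inj₁ (h , refl) = inj₂ (h , refl)
... | inj₂ (h , refl) = inj₁ (suc h , refl)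

double/2 : ∀ h → double h / 2 ≡ h
double/2 h = trans (cong (_/ 2) (trans (double≡2* h) (ℕ.*-comm 2 h))) (ℕ.m*n/n≡m h 2)

odd-length : ∀ h → ∑ (𝔖 (suc (double h))) (λ π → -1ℤ ^ des π) ≡ -1ℤ ^ (double h / 2) * + r (double h / 2)
odd-length h = begin
  ∑ (𝔖 (suc (double h))) (λ π → -1ℤ ^ des π)  ≡⟨ signed-sum (double h) ⟩
  evens (dilate (evens (altCount asc))) h     ≡⟨ evens-dilate (evens (altCount asc)) h ⟩
  -1ℤ ^ h * evens (altCount asc) h            ≡⟨ cong (-1ℤ ^ h *_) (evens-altCount h) ⟩
  -1ℤ ^ h * + r h                             ≡⟨ cong (λ k → -1ℤ ^ k * + r k) (double/2 h) ⟨
  -1ℤ ^ (double h / 2) * + r (double h / 2)   ∎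

even-length : ∀ h → ∑ (𝔖 (double (suc h))) (λ π → -1ℤ ^ des π) ≡ 0ℤ
even-length h = trans (signed-sum (suc (double h))) (dilate-isEven (evens (altCount asc)) h)

theorem6p5 : ∀ (n : ℕ) → n ≥ 1 →
    (2 ∣ n → ∑ (𝔖 n) (λ π → -1ℤ ^ des π) ≡ 0ℤ) ×
    (2 ∤ n → ∑ (𝔖 n) (λ π → -1ℤ ^ des π) ≡ (-1ℤ ^ ((n ∸ 1) / 2)) * (+ r ((n ∸ 1) / 2)))
theorem6p5 (suc n) _ = by-parity (parity n)
  where
  by-parity : (∃ λ h → n ≡ double h) ⊎ (∃ λ h → n ≡ suc (double h)) →
    (2 ∣ suc n → ∑ (𝔖 (suc n)) (λ π → -1ℤ ^ des π) ≡ 0ℤ) ×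
    (2 ∤ suc n → ∑ (𝔖 (suc n)) (λ π → -1ℤ ^ des π) ≡ (-1ℤ ^ (n / 2)) * (+ r (n / 2)))
  -- Here n is the length less one, so even n is the case of odd length.
  by-parity (inj₁ (h , refl)) = (λ 2∣n → contradiction 2∣n (2∤1+double h)) , λ _ → odd-length h
  by-parity (inj₂ (h , refl)) = (λ _ → even-length h) , contradiction (2∣double (suc h))
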